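{- The map $\psi:\bigcup_{n\ge0}\mathcal{LF}_n\to\bigcup_{n\ge0}\mathcal{UVD}_{n+1}$ is a bijection with $\mathrm{height}(Q)=\mathrm{vox}(\psi(Q))$ for every labeled $F$-path $Q$.
   Context: **UVD paths.** A UVD path of semilength $n$ is a lattice path from $(0,0)$ to $(2n,0)$ staying weakly above the $x$-axis, with steps $u=(1,1)$, $d=(1,-1)$, $v=(0,-2)$, with no consecutive $uv$ or $vu$, ending with a $d$ step. $\mathcal{UVD}_n$ is the set of these. A return is a $d$ step ending on the $x$-axis; $\mathrm{vox}(S)$ is the number of valleys $du$ of $S$ on the $x$-axis (so a nonempty $S$ has $\mathrm{vox}(S)+1$ returns), and $\mathrm{vox}(\emptyset)=-1$. **Labeled $F$-paths.** Let $F=\{(a,1):a\ge0\}\cup\{(a,b):a\ge1,b\le0\}$ ($a,b$ integers). An $F$-path is a lattice path $(x_0,y_0)=(0,0),(x_1,y_1),\dots,(x_\ell,y_\ell)$ in $\mathbb Z^2$ not going below the line $y=x$ and all of whose steps $(x_j-x_{j-1},y_j-y_{j-1})$ lie in $F$. A labeled $F$-path is an $F$-path in which each step $(a,1)$ has label $(a;1)$, and each step $(a,b)$ with $b\le0$ has a label $(a;b_1,\dots,b_k)$ with $k\ge1$, nonpositive integers $b_i$, $b_1+\cdots+b_k=b$. A step with label $(a;b_1,\dots,b_k)$ has semilength $k$ (a step labeled $(a;1)$ has semilength $1$); the semilength of the path is the sum of semilengths of its steps. $\mathcal{LF}_n$ is the set of labeled $F$-paths of semilength $n$; $\mathrm{height}(Q)=y_\ell-x_\ell$.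 **The map $\psi$** (it sends $\mathcal{LF}_n$ into $\mathcal{UVD}_{n+1}$), defined recursively. The path with no steps is sent to $ud$. For $Q$ with $\ell\ge1$ steps, let $\hat Q$ be $Q$ with its last step removed, $\hat S=\psi(\hat Q)=\hat s_1\hat s_2\cdots\hat s_N$ (word of steps), $\hat h=\mathrm{height}(\hat Q)=\mathrm{vox}(\hat S)$, so $\hat S$ has $\hat h+1$ returns. (1) If the last label is $(a;1)$, let $p$ be the index of the $(\hat h+1-a)$-th return in $\hat S$ ($p=0$ if $\hat h+1-a=0$), $\alpha=\hat s_1\cdots\hat s_p$, $\beta=\hat s_{p+1}\cdots\hat s_N$ (either may be empty); $\psi(Q)=\alpha\,u\,\beta\,d$. (2) If the last label is $(a;b_1,\dots,b_k)$ with $a\ge1$, all $b_i\le0$, let $j_i$ be the index of the $(\hat h+1+b_{i+1}+\cdots+b_k-a)$-th return of $\hat S$ for $i=0,\dots,k$, and let $p$ be the index with $\hat s_p\ne v$, $\hat s_{p+1}=\cdots=\hat s_{j_0-1}=v$, $\hat s_{j_0}=d$. Put $\alpha=\hat s_1\cdots\hat s_p$, $\beta=\hat s_{p+1}\cdots\hat s_{j_0}$, $\sigma_i=\hat s_{j_{i-1}+1}\cdots\hat s_{j_i}$ ($1\le i\le k$, possibly empty), $\tau=\hat s_{j_k+1}\cdots\hat s_N$; $\psi(Q)=\alpha\;u\sigma_1u\;u\sigma_2u\cdots u\sigma_ku\;\tau\;v^k\;\beta$. -}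

module Defs where

open import Data.Bool.Base using (Bool; true; false; _∧_; if_then_else_)
open import Data.Integer.Base as ℤ using (ℤ; +_; -[1+_]; 0ℤ; 1ℤ; -1ℤ)
import Data.Integer.Properties as ℤ
open import Data.List.Base using
  ( List; []; _∷_; [_]; _++_; _∷ʳ_; map; foldl; foldr; concatMap; upTo
  ; take; drop; replicate; reverse; dropWhileᵇ; length; last )
open import Data.List.NonEmpty.Base as List⁺ using (List⁺)
open import Data.List.Relation.Unary.All using (All)
open import Data.List.Relation.Unary.Linked using (Linked)
open import Data.List.Reverse using (Reverse; []; _∶_∶ʳ_; reverseView)
open import Data.List.Scans.Base using (scanl)
open import Data.Maybe.Base using (just)
open import Data.Nat.Base as ℕ using (ℕ; zero; suc; _∸_)
import Data.Nat.ListAction as ℕ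
open import Data.Product.Base using (_×_; _,_; proj₁; proj₂)
open import Level using (0ℓ)
open import Relation.Binary.PropositionalEquality using (_≡_)
open import Relation.Nullary using (¬_)
open import Relation.Nullary.Decidable.Core using (does)
open import Relation.Unary using (Pred)

-- A lattice path is given by its list of steps and starts at (0,0).
Point : Set
Point = ℤ × ℤ

_⊕_ : Point → Point → Point
(x , y) ⊕ (x′ , y′) = (x ℤ.+ x′ , y ℤ.+ y′)

origin : Point
origin = (0ℤ , 0ℤ)

endpoint : List Point → Point
endpoint = foldl _⊕_ origin

vertices : List Point → List Point
vertices = scanl _⊕_ origin

data Step : Set where
  u d v : Step

vec : Step → Point
vec u = (1ℤ , 1ℤ)
vec d = (1ℤ , -1ℤ)
vec v = (0ℤ , ℤ.- (+ 2))

data UVorVU : Step → Step → Set where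
  uv : UVorVU u v
  vu : UVorVU v u

record UVD (n : ℕ) (S : List Step) : Set where
  field
    ends-at   : endpoint (map vec S) ≡ (+ (2 ℕ.* n) , 0ℤ)
    above     : All (λ p → 0ℤ ℤ.≤ proj₂ p) (vertices (map vec S))
    no-uv-vu  : Linked (λ s t → ¬ UVorVU s t) S
    ends-in-d : last S ≡ just d

-- In isReturn, returnIndexFrom and axisValleysFrom the argument y is the height of the vertex
-- from which the given step, or word of steps, starts.

isReturn : ℤ → Step → Bool
isReturn y d = does (y ℤ.+ proj₂ (vec d) ℤ.≟ 0ℤ)
isReturn y u = false
isReturn y v = false

returnIndexFrom : ℤ → ℕ → List Step → ℕ
returnIndexFrom y zero    S       = 0
returnIndexFrom y (suc m) []      = 0
returnIndexFrom y (suc m) (s ∷ S) =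
  suc (returnIndexFrom (y ℤ.+ proj₂ (vec s)) (if isReturn y s then m else suc m) S)

startsWithU : List Step → Bool
startsWithU (u ∷ _) = true
startsWithU _       = false

axisValleysFrom : ℤ → List Step → ℕ
axisValleysFrom y []      = 0
axisValleysFrom y (s ∷ S) =
  (if isReturn y s ∧ startsWithU S then 1 else 0)
    ℕ.+ axisValleysFrom (y ℤ.+ proj₂ (vec s)) S

-- The 1-based index in S of the m-th return, and 0 if m = 0.  The value is
-- meaningless if m is negative or exceeds the number of returns of S.
returnIndex : ℤ → List Step → ℕ
returnIndex (+ m)    S = returnIndexFrom 0ℤ m S
returnIndex -[1+ _ ] S = 0

vox : List Step → ℤ
vox []        = -1ℤ
vox S@(_ ∷ _) = + axisValleysFrom 0ℤ S

data F : Pred Point 0ℓ where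
  rise : ∀ {a}   → 0ℤ ℤ.≤ a → F (a , 1ℤ)
  fall : ∀ {a b} → 1ℤ ℤ.≤ a → b ℤ.≤ 0ℤ → F (a , b)

FPath : Pred (List Point) 0ℓ
FPath P = All F P × All (λ p → proj₁ p ℤ.≤ proj₂ p) (vertices P)

sumℤ : List ℤ → ℤ
sumℤ = foldr ℤ._+_ 0ℤ

-- A label determines the step that carries it, so a labeled path is given
-- by its list of labels alone.
data Label : Set where
  ⟨_⨾1⟩ : (a : ℤ) → Label
  ⟨_⨾_⟩ : (a : ℤ) (bs : List⁺ ℤ) → Label

step : Label → Point
step ⟨ a ⨾1⟩     = (a , 1ℤ)
step ⟨ a ⨾ bs ⟩  = (a , sumℤ (List⁺.toList bs))

-- The conditions on a are imposed by requiring that step l lies in F.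
data ValidLabel : Pred Label 0ℓ where
  one   : ∀ {a}    → ValidLabel ⟨ a ⨾1⟩
  parts : ∀ {a bs} → All (ℤ._≤ 0ℤ) (List⁺.toList bs) → ValidLabel ⟨ a ⨾ bs ⟩

labelSemilength : Label → ℕ
labelSemilength ⟨ a ⨾1⟩    = 1
labelSemilength ⟨ a ⨾ bs ⟩ = List⁺.length bs

semilength : List Label → ℕ
semilength Q = ℕ.sum (map labelSemilength Q)

LabeledFPath : Pred (List Label) 0ℓ
LabeledFPath Q = FPath (map step Q) × All ValidLabel Q

LF : ℕ → Pred (List Label) 0ℓ
LF n Q = LabeledFPath Q × semilength Q ≡ n

height : List Label → ℤ
height Q = let (x , y) = endpoint (map step Q) in y ℤ.- x

-- The factor s_{i+1} ⋯ s_j of s₁ ⋯ s_N.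
factor : ℕ → ℕ → List Step → List Step
factor i j S = drop i (take j S)

isV : Step → Bool
isV v = true
isV u = false
isV d = false

-- One recursion step of ψ, for a path Q̂ ∷ʳ l with h = height Q̂ and S = ψ Q̂.
extend : ℤ → List Step → Label → List Step
extend h S ⟨ a ⨾1⟩ = α ++ [ u ] ++ β ++ [ d ]
  where
  p = returnIndex (h ℤ.+ 1ℤ ℤ.- a) S
  α = take p S
  β = drop p S
extend h S ⟨ a ⨾ bs ⟩ =
  α ++ concatMap (λ i → [ u ] ++ σ (suc i) ++ [ u ]) (upTo k) ++ τ ++ replicate k v ++ β
  where
  k = List⁺.length bs

  -- drop i bs is b_{i+1}, …, b_k.
  j : ℕ → ℕ
  j i = returnIndex (h ℤ.+ 1ℤ ℤ.+ sumℤ (drop i (List⁺.toList bs)) ℤ.- a) S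

  -- What remains of s₁ ⋯ s_{j₀-1} after deleting its final run of v's is s₁ ⋯ s_p.
  p = length (dropWhileᵇ isV (reverse (take (j 0 ∸ 1) S)))

  α = take p S
  β = factor p (j 0) S
  τ = drop (j k) S

  σ : ℕ → List Step
  σ i = factor (j (i ∸ 1)) (j i) S

ψ-view : {Q : List Label} → Reverse Q → List Step
ψ-view []            = u ∷ d ∷ []
ψ-view (Q̂ ∶ r ∶ʳ l) = extend (height Q̂) (ψ-view r) l

-- The word ψ Q is the intended one when Q is a labeled F-path; other lists of
-- labels are sent to arbitrary words.
ψ : List Label → List Step
ψ Q = ψ-view (reverseView Q)

{-# OPTIONS --safe #-}
-- A UVD path is a nonempty sequence of arches, and ψ acts on that sequence: case
-- (1) encloses the last a arches in a new one, case (2) merges the arches behind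
-- a chosen arch c into c.  Reading the two cases as constructors of trees turns
-- ψ into a map from labeled F-paths to nonempty forests; it is bijective because
-- the outermost constructor of the last tree, together with the sizes of the
-- forests in it, determines the last label and the preceding forest.
-- It remains to see that each UVD path is the word of exactly one forest.
-- Cutting a prefix ending at height h at its last passages through the levels
-- 0, …, h gives h + 1 words of forests; an up step adds an empty one, and a run
-- of M v's followed by d combines the top 2M + 1 of them into a tree.  The j-th v
-- of the run removes two forests τ and σ, and it belongs to the same use of case
-- (2) as the v before it exactly when τ is empty: a nonempty τ ends in d, so
-- that a run of v's may follow it.
module Submission where

open import Defs
open import Data.Empty using (⊥-elim)
open import Data.Integer.Base as ℤ using (ℤ; +_; -[1+_]; 0ℤ; 1ℤ)
import Data.Integer.Properties as ℤ
import Data.Integer.Tactic.RingSolver as ℤ-Solver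
open import Data.List.Base hiding (scanl; sum)
open import Data.List.NonEmpty.Base using (_∷_)
open import Data.List.Properties hiding (sum-++)
open import Data.List.Relation.Unary.All as All using (All; []; _∷_)
open import Data.List.Relation.Unary.All.Properties using (++⁺; ++⁻ˡ; ++⁻ʳ; map⁺)
open import Data.List.Relation.Unary.Linked as Linked using (Linked; [-]; _∷_)
open import Data.List.Reverse using (Reverse; []; _∶_∶ʳ_; reverseView)
open import Data.List.Scans.Base using (scanl)
open import Data.Maybe.Base using (just)
open import Data.Nat.Base as ℕ using (ℕ; zero; suc; _+_; _*_; _∸_; _≤_; s≤s; z≤n)
open import Data.Nat.ListAction using (sum)
open import Data.Nat.ListAction.Properties using (sum-++)
import Data.Nat.Properties as ℕ
import Data.Nat.Tactic.RingSolver as ℕ-Solver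
open import Data.Product.Base using (Σ-syntax; ∃; ∃₂; _×_; _,_; proj₁; proj₂)
open import Function.Base using (_on_; flip; _∘_)
open import Function.Definitions using (Bijective)
open import Relation.Binary.PropositionalEquality hiding ([_])
open import Relation.Nullary using (¬_)
open import Relation.Unary using (⋃)
open import Tactic.MonoidSolver using (solve)

-- Words of forests

-- A forest is listed from its last tree to its first, since ψ acts at the end
-- of a path.  node B is the arch u B d, and grow c σ σs t T is the result of
-- case (2) of ψ on the arch c followed by σ₁, …, σ_k and the nonempty τ; here
-- σ ∷ σs is σ₁, …, σ_k and t ∷ T is τ.
data Tree : Set where
  node : List Tree → Tree
  grow : Tree → List Tree → List (List Tree) → Tree → List Tree → Tree

depth : Tree → ℕ
depth (node B)          = 0
depth (grow c σ σs t T) = suc (length σs) + depth c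

word   : List Tree → List Step
arch   : Tree → List Step
shaft  : Tree → List Step
core   : Tree → List Step
climb  : List Tree → List Step
climbs : List (List Tree) → List Step

word []      = []
word (t ∷ F) = word F ++ arch t

arch t = u ∷ shaft t ++ [ d ]

shaft t = core t ++ replicate (depth t) v

core (node B)          = word B
core (grow c σ σs t T) = core c ++ (climb σ ++ climbs σs) ++ word T ++ arch t

climb σ = u ∷ word σ ++ [ u ]

climbs []       = []
climbs (σ ∷ σs) = climb σ ++ climbs σs

word-++ : ∀ F G → word (F ++ G) ≡ word G ++ word F
word-++ []      G = sym (++-identityʳ _)
word-++ (t ∷ F) G = trans (cong (_++ arch t) (word-++ F G)) (++-assoc (word G) (word F) (arch t))

-- Since forests are listed backwards, the forests that follow `G` in a word are put in front of it
-- one after the other: the result is σ_k, ..., σ₁, `G` concatenated in this order.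
pile : List Tree → List (List Tree) → List Tree
pile = foldl (flip _++_)

word-pile : ∀ G σs → word (pile G σs) ≡ word G ++ concatMap word σs
word-pile G []       = sym (++-identityʳ _)
word-pile G (σ ∷ σs) = begin
  word (pile (σ ++ G) σs)                    ≡⟨ word-pile (σ ++ G) σs ⟩
  word (σ ++ G) ++ concatMap word σs         ≡⟨ cong (_++ concatMap word σs) (word-++ σ G) ⟩
  (word G ++ word σ) ++ concatMap word σs    ≡⟨ ++-assoc (word G) (word σ) _ ⟩
  word G ++ word σ ++ concatMap word σs      ∎
  where open ≡-Reasoning

-- In Walk r h S s k the word S leads from height h to height k; r is the step
-- before S, and s is the last step of r ∷ S.
data Walk : Step → ℕ → List Step → Step → ℕ → Set where
  []     : ∀ {r h} → Walk r h [] r h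
  up     : ∀ {r h S s k} → r ≢ v → Walk u (suc h) S s k → Walk r h (u ∷ S) s k
  down   : ∀ {r h S s k} → Walk d h S s k → Walk r (suc h) (d ∷ S) s k
  plunge : ∀ {r h S s k} → r ≢ u → Walk v h S s k → Walk r (2 + h) (v ∷ S) s k

infixr 5 _++ʷ_

_++ʷ_ : ∀ {r h S s k S′ s′ k′} → Walk r h S s k → Walk s k S′ s′ k′ → Walk r h (S ++ S′) s′ k′
[]         ++ʷ w = w
up x w′     ++ʷ w = up x (w′ ++ʷ w)
down w′     ++ʷ w = down (w′ ++ʷ w)
plunge x w′ ++ʷ w = plunge x (w′ ++ʷ w)

walk-last : ∀ {x r h S s k} → Walk r h (x ∷ S) s k → last (x ∷ S) ≡ just s
walk-last {S = []}     (up _ [])         = refl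
walk-last {S = []}     (down [])         = refl
walk-last {S = []}     (plunge _ [])     = refl
walk-last {S = _ ∷ _}  (up _ w)          = walk-last w
walk-last {S = _ ∷ _}  (down w)          = walk-last w
walk-last {S = _ ∷ _}  (plunge _ w)      = walk-last w

lastStep : Step → List Tree → Step
lastStep r []      = r
lastStep r (_ ∷ _) = d

lastStep≢v : ∀ {r} F → r ≢ v → lastStep r F ≢ v
lastStep≢v []      r≢v = r≢v
lastStep≢v (_ ∷ _) _   = λ ()

-- The last step of `u ∷ core t`. As it is never v, the run of v's before the last d of `arch t` is
-- exactly `replicate (depth t) v`, which is what case (2) has to locate.
top : Tree → Step
top (node B)           = lastStep u B
top (grow _ _ _ _ _)   = d

top≢v : ∀ t → top t ≢ v
top≢v (node B)         = lastStep≢v B (λ ())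
top≢v (grow _ _ _ _ _) = λ ()

plunges-walk : ∀ n {r h} → r ≢ u → ∃ λ s → Walk r (n * 2 + h) (replicate n v) s h
plunges-walk zero    r≢u = _ , []
plunges-walk (suc n) r≢u with s , w ← plunges-walk n {v} (λ ()) = s , plunge r≢u w

word-walk   : ∀ F {r h} → r ≢ v → Walk r h (word F) (lastStep r F) h
arch-walk   : ∀ t {r h} → r ≢ v → Walk r h (arch t) d h
shaft-walk  : ∀ t {h} → ∃ λ s → Walk u h (shaft t) s h
-- Each `climb` ends two levels above its start, and the run of `depth t` v's in `shaft t` takes
-- this surplus back.
core-walk   : ∀ t {h} → Walk u h (core t) (top t) (depth t * 2 + h)
climb-walk  : ∀ σ {r h} → r ≢ v → Walk r h (climb σ) u (2 + h)
climbs-walk : ∀ σs {h} → Walk u h (climbs σs) u (length σs * 2 + h)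

word-walk []      r≢v = []
word-walk (t ∷ F) r≢v = word-walk F r≢v ++ʷ arch-walk t (lastStep≢v F r≢v)

arch-walk t r≢v = up r≢v (proj₂ (shaft-walk t) ++ʷ down [])

shaft-walk (node B)            = _ , core-walk (node B) ++ʷ []
shaft-walk t@(grow c σ σs r T) = _ , core-walk t ++ʷ proj₂ (plunges-walk (depth t) (λ ()))

core-walk (node B)              = word-walk B (λ ())
core-walk (grow c σ σs t T) {h} = subst (Walk u h _ d) lemma
  (core-walk c ++ʷ (climb-walk σ (top≢v c) ++ʷ climbs-walk σs)
    ++ʷ word-walk T (λ ()) ++ʷ arch-walk t (lastStep≢v T (λ ())))
  where
  k = length σs
  m = depth c
  lemma : k * 2 + (2 + (m * 2 + h)) ≡ suc (suc ((k + m) * 2 + h))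
  lemma = begin
    k * 2 + (2 + (m * 2 + h))  ≡⟨ ℕ.+-suc (k * 2) _ ⟩
    suc (k * 2 + suc (m * 2 + h)) ≡⟨ cong suc (ℕ.+-suc (k * 2) _) ⟩
    2 + (k * 2 + (m * 2 + h))  ≡⟨ cong (suc ∘ suc) (ℕ.+-assoc (k * 2) (m * 2) h) ⟨
    2 + (k * 2 + m * 2 + h)    ≡⟨ cong (λ x → 2 + (x + h)) (ℕ.*-distribʳ-+ 2 k m) ⟨
    2 + ((k + m) * 2 + h)      ∎
    where open ≡-Reasoning

climb-walk σ r≢v = up r≢v (word-walk σ (λ ()) ++ʷ up (lastStep≢v σ (λ ())) [])

climbs-walk []           = []
climbs-walk (σ ∷ σs) {h} = subst (Walk u h _ u)
  (trans (ℕ.+-suc (length σs * 2) _) (cong suc (ℕ.+-suc (length σs * 2) h)))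
  (climb-walk σ (λ ()) ++ʷ climbs-walk σs)

-- Walks and UVD paths

width : List Step → ℕ
width []      = 0
width (u ∷ S) = suc (width S)
width (d ∷ S) = suc (width S)
width (v ∷ S) = width S

width-++ : ∀ S T → width (S ++ T) ≡ width S + width T
width-++ []      T = refl
width-++ (u ∷ S) T = cong suc (width-++ S T)
width-++ (d ∷ S) T = cong suc (width-++ S T)
width-++ (v ∷ S) T = width-++ S T

walk-endpoint : ∀ {r h S s k} x → Walk r h S s k →
  foldl _⊕_ (+ x , + h) (map vec S) ≡ (+ (x + width S) , + k)
walk-endpoint x [] = cong (λ y → (+ y , _)) (sym (ℕ.+-identityʳ x))
walk-endpoint {h = h} {S = u ∷ S} x (up _ w)
  rewrite ℕ.+-comm x 1 | ℕ.+-comm h 1 | ℕ.+-suc x (width S) = walk-endpoint (suc x) w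
walk-endpoint {S = d ∷ S} x (down w) rewrite ℕ.+-comm x 1 | ℕ.+-suc x (width S) = walk-endpoint (suc x) w
walk-endpoint x (plunge _ w) rewrite ℕ.+-identityʳ x = walk-endpoint x w

walk-above : ∀ {r h S s k} x → Walk r h S s k →
  All (λ p → 0ℤ ℤ.≤ proj₂ p) (scanl _⊕_ (x , + h) (map vec S))
walk-above x [] = ℤ.+≤+ ℕ.z≤n ∷ []
walk-above {h = h} x (up _ w) rewrite ℕ.+-comm h 1 = ℤ.+≤+ ℕ.z≤n ∷ walk-above _ w
walk-above x (down w) = ℤ.+≤+ ℕ.z≤n ∷ walk-above _ w
walk-above x (plunge _ w) = ℤ.+≤+ ℕ.z≤n ∷ walk-above _ w

walk-linked : ∀ {r h S s k} → Walk r h S s k → Linked (λ s t → ¬ UVorVU s t) (r ∷ S)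
walk-linked []           = [-]
walk-linked (up r≢v w)     = (λ { vu → r≢v refl }) ∷ walk-linked w
walk-linked (down w)     = (λ ()) ∷ walk-linked w
walk-linked (plunge r≢u w) = (λ { uv → r≢u refl }) ∷ walk-linked w

toWalk : ∀ r h x S → All (λ p → 0ℤ ℤ.≤ proj₂ p) (scanl _⊕_ (x , + h) (map vec S)) →
  Linked (λ s t → ¬ UVorVU s t) (r ∷ S) → ∃₂ (Walk r h S)
toWalk r h x [] _ _ = r , h , []
toWalk r h x (u ∷ S) (_ ∷ abv) (nvu ∷ lnk) rewrite ℕ.+-comm h 1
  with s , k , w ← toWalk u (suc h) _ S abv lnk = s , k , up (λ { refl → nvu vu }) w
toWalk r zero x (d ∷ S) (_ ∷ () ∷ _) lnk
toWalk r (suc h) x (d ∷ S) (_ ∷ abv) (_ ∷ lnk)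
  with s , k , w ← toWalk d h _ S abv lnk = s , k , down w
toWalk r zero x (v ∷ S) (_ ∷ () ∷ _) lnk
toWalk r (suc zero) x (v ∷ S) (_ ∷ () ∷ _) lnk
toWalk r (suc (suc h)) x (v ∷ S) (_ ∷ abv) (nuv ∷ lnk)
  with s , k , w ← toWalk v h _ S abv lnk = s , k , plunge (λ { refl → nuv uv }) w

-- A d imagined before the first step is compatible with every step, and it lets the empty word pass
-- as ending in d; hence the condition `S ≢ []`.
walk⇒UVD : ∀ {n S} → width S ≡ 2 * n → S ≢ [] → Walk d 0 S d 0 → UVD n S
walk⇒UVD {S = []} _ S≢[] _ = ⊥-elim (S≢[] refl)
walk⇒UVD {S = S@(_ ∷ _)} eq _ w = record
  { ends-at   = trans (walk-endpoint 0 w) (cong (λ x → (+ x , 0ℤ)) eq)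
  ; above     = walk-above 0ℤ w
  ; no-uv-vu  = Linked.tail (walk-linked w)
  ; ends-in-d = walk-last w
  }

UVD⇒walk : ∀ {n S} → UVD n S → Walk d 0 S d 0
UVD⇒walk {S = []} S∈UVD with () ← UVD.ends-in-d S∈UVD
UVD⇒walk {S = S@(x ∷ S′)} S∈UVD
  with s , k , w ← toWalk d 0 0ℤ S (UVD.above S∈UVD) ((λ ()) ∷ UVD.no-uv-vu S∈UVD)
  with refl ← trans (sym (walk-last w)) (UVD.ends-in-d S∈UVD)
  with refl ← cong proj₂ (trans (sym (walk-endpoint 0 w)) (UVD.ends-at S∈UVD))
  = w

-- Parsing

replicate-+ : ∀ {A : Set} m n (x : A) → replicate (m + n) x ≡ replicate m x ++ replicate n x
replicate-+ zero    n x = refl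
replicate-+ (suc m) n x = cong (x ∷_) (replicate-+ m n x)

replicate-∷ʳ : ∀ {A : Set} n (x : A) → replicate (suc n) x ≡ replicate n x ∷ʳ x
replicate-∷ʳ n x = trans (cong (λ m → replicate m x) (ℕ.+-comm 1 n)) (replicate-+ n 1 x)

-- One use of case (2) whose arch `c` is still unknown: the arguments of `grow` other than `c`,
-- which `plant` supplies.
data Block : Set where
  block : List Tree → List (List Tree) → Tree → List Tree → Block

plant : Tree → Block → Tree
plant c (block σ σs t T) = grow c σ σs t T

-- After a prefix of a word, the state holds the forests between its last
-- passages through the successive levels, the highest first, and the blocks
-- completed by a final run of v's, the lowest first.
State : Set
State = List (List Tree) × List Block

-- A run of v's meets σ_k first and σ₁ last. Nothing lies between the factors uσᵢu and uσᵢ₊₁u, so an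
-- empty `T` means that the lowest block continues downwards with `σ` as its new first entry; a
-- nonempty `T` is the τ of a new block.
push : List Tree → List Tree → List Block → List Block
push []      σ []                     = []  -- junk: the word contains uv
push []      σ (block σ′ σs t T ∷ ps) = block σ (σ′ ∷ σs) t T ∷ ps
push (t ∷ T) σ ps                     = block σ [] t T ∷ ps

δ : State → Step → State
δ (st , ps)         u = [] ∷ st , ps
-- The arch being closed starts as `node B`, and the blocks of the run of v's before this d are
-- planted on it, the innermost first.
δ (B ∷ C ∷ st , ps) d = (foldl plant (node B) ps ∷ C) ∷ st , []
δ (T ∷ σ ∷ st , ps) v = st , push T σ ps
-- A default for stacks with too few forests, which do not occur along a UVD path.
δ s                 _ = s

parse : State → List Step → State
parse = foldl δ

-- The stack below the top after the factors uσ₁u, ..., uσ_ku: between consecutive σ's lies the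
-- empty forest of the level where one factor ends and the next begins. Likewise `levels t st` is
-- the stack after `core t`.
rungs : List Tree → List (List Tree) → List (List Tree) → List (List Tree)
rungs σ []        st = σ ∷ st
rungs σ (σ′ ∷ σs) st = rungs σ′ σs ([] ∷ σ ∷ st)

levels : Tree → List (List Tree) → List (List Tree)
levels (node B)          st = B ∷ st
levels (grow c σ σs t T) st = (t ∷ T) ∷ rungs σ σs (levels c st)

-- The first σ lies deepest and is removed by the last v, so the induction splits the run at its
-- end. That last v finds an empty forest above σ and extends the block.
parse-v : ∀ σ σs t T st ps →
  parse ((t ∷ T) ∷ rungs σ σs st , ps) (replicate (suc (length σs)) v) ≡ (st , block σ σs t T ∷ ps)
parse-v σ []        t T st ps = refl
parse-v σ (σ′ ∷ σs) t T st ps = begin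
  parse s (replicate (2 + n) v)                 ≡⟨ cong (parse s) (replicate-∷ʳ (suc n) v) ⟩
  parse s (replicate (suc n) v ∷ʳ v)            ≡⟨ foldl-∷ʳ δ s v (replicate (suc n) v) ⟩
  δ (parse s (replicate (suc n) v)) v           ≡⟨ cong (flip δ v) (parse-v σ′ σs t T ([] ∷ σ ∷ st) ps) ⟩
  st , block σ (σ′ ∷ σs) t T ∷ ps               ∎
  where
  open ≡-Reasoning
  n = length σs
  s = (t ∷ T) ∷ rungs σ (σ′ ∷ σs) st , ps

-- The induction goes inwards through the `grow`s of a tree. The blocks of the outer ones wait in
-- `ps` until the d plants them all again.
parse-plunge : ∀ t ps C st →
  parse (levels t (C ∷ st) , ps) (replicate (depth t) v ++ [ d ]) ≡ ((foldl plant t ps ∷ C) ∷ st , [])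
parse-plunge (node B)          ps C st = refl
parse-plunge t′@(grow c σ σs t T) ps C st = begin
  parse s (replicate (depth t′) v ++ [ d ])
    ≡⟨ cong (λ S → parse s (S ++ [ d ])) (replicate-+ (suc n) (depth c) v) ⟩
  parse s ((replicate (suc n) v ++ replicate (depth c) v) ++ [ d ])
    ≡⟨ cong (parse s) (++-assoc (replicate (suc n) v) _ _) ⟩
  parse s (replicate (suc n) v ++ replicate (depth c) v ++ [ d ])
    ≡⟨ foldl-++ δ s (replicate (suc n) v) _ ⟩
  parse (parse s (replicate (suc n) v)) (replicate (depth c) v ++ [ d ])
    ≡⟨ cong (λ s → parse s (replicate (depth c) v ++ [ d ])) (parse-v σ σs t T _ ps) ⟩
  parse (levels c (C ∷ st) , block σ σs t T ∷ ps) (replicate (depth c) v ++ [ d ])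
    ≡⟨ parse-plunge c (block σ σs t T ∷ ps) C st ⟩
  (foldl plant t′ ps ∷ C) ∷ st , [] ∎
  where
  open ≡-Reasoning
  n = length σs
  s = levels t′ (C ∷ st) , ps

-- Here `C` is what the current level already holds. An arch opens a level with its u and closes it
-- with its d, so the levels in `st` stay as they were.
parse-word   : ∀ F C st → parse (C ∷ st , []) (word F) ≡ ((F ++ C) ∷ st , [])
parse-arch   : ∀ t C st → parse (C ∷ st , []) (arch t) ≡ ((t ∷ C) ∷ st , [])
parse-core   : ∀ t st → parse ([] ∷ st , []) (core t) ≡ (levels t st , [])
parse-climb  : ∀ σ st → parse (st , []) (climb σ) ≡ ([] ∷ σ ∷ st , [])
parse-climbs : ∀ σ σs st → parse ([] ∷ σ ∷ st , []) (climbs σs) ≡ ([] ∷ rungs σ σs st , [])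

parse-word []      C st = refl
parse-word (t ∷ F) C st = begin
  parse (C ∷ st , []) (word F ++ arch t)          ≡⟨ foldl-++ δ _ (word F) (arch t) ⟩
  parse (parse (C ∷ st , []) (word F)) (arch t)   ≡⟨ cong (λ s → parse s (arch t)) (parse-word F C st) ⟩
  parse ((F ++ C) ∷ st , []) (arch t)             ≡⟨ parse-arch t (F ++ C) st ⟩
  (t ∷ F ++ C) ∷ st , []                          ∎
  where open ≡-Reasoning

parse-arch t C st = begin
  parse s (shaft t ++ [ d ])                      ≡⟨ cong (parse s) (++-assoc (core t) _ _) ⟩
  parse s (core t ++ replicate (depth t) v ++ [ d ]) ≡⟨ foldl-++ δ s (core t) _ ⟩
  parse (parse s (core t)) (replicate (depth t) v ++ [ d ])
    ≡⟨ cong (λ s → parse s (replicate (depth t) v ++ [ d ])) (parse-core t (C ∷ st)) ⟩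
  parse (levels t (C ∷ st) , []) (replicate (depth t) v ++ [ d ])
    ≡⟨ parse-plunge t [] C st ⟩
  (t ∷ C) ∷ st , [] ∎
  where
  open ≡-Reasoning
  s = [] ∷ C ∷ st , []

parse-core (node B)          st = trans (parse-word B [] st) (cong (λ B → B ∷ st , []) (++-identityʳ B))
parse-core (grow c σ σs t T) st = begin
  parse s₀ (core c ++ (climb σ ++ climbs σs) ++ word T ++ arch t)
    ≡⟨ foldl-++ δ s₀ (core c) _ ⟩
  parse (parse s₀ (core c)) ((climb σ ++ climbs σs) ++ word T ++ arch t)
    ≡⟨ cong (λ s → parse s ((climb σ ++ climbs σs) ++ word T ++ arch t)) (parse-core c st) ⟩
  parse (levels c st , []) ((climb σ ++ climbs σs) ++ word T ++ arch t)
    ≡⟨ cong (parse (levels c st , [])) (++-assoc (climb σ) (climbs σs) _) ⟩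
  parse (levels c st , []) (climb σ ++ climbs σs ++ word T ++ arch t)
    ≡⟨ foldl-++ δ (levels c st , []) (climb σ) _ ⟩
  parse (parse (levels c st , []) (climb σ)) (climbs σs ++ word T ++ arch t)
    ≡⟨ cong (λ s → parse s (climbs σs ++ word T ++ arch t)) (parse-climb σ (levels c st)) ⟩
  parse ([] ∷ σ ∷ levels c st , []) (climbs σs ++ word T ++ arch t)
    ≡⟨ foldl-++ δ ([] ∷ σ ∷ levels c st , []) (climbs σs) _ ⟩
  parse (parse ([] ∷ σ ∷ levels c st , []) (climbs σs)) (word T ++ arch t)
    ≡⟨ cong (λ s → parse s (word T ++ arch t)) (parse-climbs σ σs (levels c st)) ⟩
  parse s₁ (word T ++ arch t)
    ≡⟨ foldl-++ δ s₁ (word T) _ ⟩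
  parse (parse s₁ (word T)) (arch t)
    ≡⟨ cong (λ s → parse s (arch t)) (parse-word T [] _) ⟩
  parse ((T ++ []) ∷ rungs σ σs (levels c st) , []) (arch t)
    ≡⟨ parse-arch t (T ++ []) _ ⟩
  (t ∷ T ++ []) ∷ rungs σ σs (levels c st) , []
    ≡⟨ cong (λ T → (t ∷ T) ∷ rungs σ σs (levels c st) , []) (++-identityʳ T) ⟩
  (t ∷ T) ∷ rungs σ σs (levels c st) , [] ∎
  where
  open ≡-Reasoning
  s₀ = [] ∷ st , []
  s₁ = [] ∷ rungs σ σs (levels c st) , []

parse-climb σ st = begin
  parse ([] ∷ st , []) (word σ ++ [ u ])     ≡⟨ foldl-∷ʳ δ _ u (word σ) ⟩
  δ (parse ([] ∷ st , []) (word σ)) u        ≡⟨ cong (flip δ u) (parse-word σ [] st) ⟩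
  [] ∷ (σ ++ []) ∷ st , []                   ≡⟨ cong (λ σ → [] ∷ σ ∷ st , []) (++-identityʳ σ) ⟩
  [] ∷ σ ∷ st , []                           ∎
  where open ≡-Reasoning

parse-climbs σ []        st = refl
parse-climbs σ (σ′ ∷ σs) st = begin
  parse s (climb σ′ ++ climbs σs)            ≡⟨ foldl-++ δ s (climb σ′) _ ⟩
  parse (parse s (climb σ′)) (climbs σs)     ≡⟨ cong (λ s → parse s (climbs σs)) (parse-climb σ′ _) ⟩
  parse ([] ∷ σ′ ∷ [] ∷ σ ∷ st , []) (climbs σs) ≡⟨ parse-climbs σ′ σs ([] ∷ σ ∷ st) ⟩
  [] ∷ rungs σ (σ′ ∷ σs) st , []             ∎
  where
  open ≡-Reasoning
  s = [] ∷ σ ∷ st , []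

-- Started from a single empty forest, `parse` recovers a forest from its word.
word-injective : ∀ {F G} → word F ≡ word G → F ≡ G
word-injective {F} {G} eq = begin
  F         ≡⟨ ++-identityʳ F ⟨
  F ++ []   ≡⟨ ∷-injectiveˡ (cong proj₁ same) ⟩
  G ++ []   ≡⟨ ++-identityʳ G ⟩
  G         ∎
  where
  open ≡-Reasoning
  same : ((F ++ []) ∷ [] , []) ≡ ((G ++ []) ∷ [] , [])
  same = trans (sym (parse-word F [] [])) (trans (cong (parse ([] ∷ [] , [])) eq) (parse-word G [] []))

-- Every UVD path is the word of a forest

unwind : List (List Tree) → List Step
unwind []               = []
unwind (C ∷ [])         = word C
unwind (C ∷ st@(_ ∷ _)) = unwind st ++ u ∷ word C

ascent : Block → List Step
ascent (block σ σs t T) = (climb σ ++ climbs σs) ++ word T ++ arch t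

plunges : Block → ℕ
plunges (block σ σs t T) = suc (length σs)

-- The word read so far, recovered from the state: the forests of the stack separated by the u's
-- that lead from level to level for the last time, the ascending parts of the pending blocks, and
-- the run of v's just read.
render : State → List Step
render (st , ps) = unwind st ++ concatMap ascent ps ++ replicate (sum (map plunges ps)) v

core-foldl-plant : ∀ c ps → core (foldl plant c ps) ≡ core c ++ concatMap ascent ps
core-foldl-plant c []                     = sym (++-identityʳ _)
core-foldl-plant c (p@(block σ σs t T) ∷ ps) =
  trans (core-foldl-plant (plant c p) ps) (++-assoc (core c) (ascent p) _)

depth-foldl-plant : ∀ c ps → depth (foldl plant c ps) ≡ sum (map plunges ps) + depth c
depth-foldl-plant c []                     = refl
depth-foldl-plant c (p@(block σ σs t T) ∷ ps) = begin
  depth (foldl plant (plant c p) ps)  ≡⟨ depth-foldl-plant (plant c p) ps ⟩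
  n + (plunges p + depth c)           ≡⟨ ℕ.+-assoc n (plunges p) _ ⟨
  n + plunges p + depth c             ≡⟨ cong (_+ depth c) (ℕ.+-comm n (plunges p)) ⟩
  plunges p + n + depth c             ∎
  where
  open ≡-Reasoning
  n = sum (map plunges ps)

-- Together with `render-d` and `render-v` this shows that a step of the parse loses nothing: the
-- rendered word grows by the step read.
render-u : ∀ C st → render ([] ∷ C ∷ st , []) ≡ render (C ∷ st , []) ∷ʳ u
render-u C st = lemma (unwind (C ∷ st)) [ u ]
  where
  lemma : ∀ (x y : List Step) → (x ++ y) ++ [] ≡ (x ++ []) ++ y
  lemma x y = solve (++-monoid Step)

render-d : ∀ B C st ps →
  render ((foldl plant (node B) ps ∷ C) ∷ st , []) ≡ render (B ∷ C ∷ st , ps) ∷ʳ d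
render-d B C st ps = begin
  unwind ((t ∷ C) ∷ st) ++ []   ≡⟨ ++-identityʳ _ ⟩
  unwind ((t ∷ C) ∷ st)         ≡⟨ unwind-∷ st ⟩
  unwind (C ∷ st) ++ arch t     ≡⟨ cong (λ S → unwind (C ∷ st) ++ u ∷ S ++ [ d ]) shaft-t ⟩
  unwind (C ∷ st) ++ u ∷ ((word B ++ concatMap ascent ps) ++ replicate n v) ++ [ d ]
    ≡⟨ lemma (unwind (C ∷ st)) [ u ] (word B) (concatMap ascent ps) (replicate n v) [ d ] ⟩
  render (B ∷ C ∷ st , ps) ∷ʳ d ∎
  where
  open ≡-Reasoning
  t = foldl plant (node B) ps
  n = sum (map plunges ps)
  shaft-t : shaft t ≡ (word B ++ concatMap ascent ps) ++ replicate n v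
  shaft-t = cong₂ _++_ (core-foldl-plant (node B) ps)
    (cong (λ m → replicate m v) (trans (depth-foldl-plant (node B) ps) (ℕ.+-identityʳ n)))
  unwind-∷ : ∀ st → unwind ((t ∷ C) ∷ st) ≡ unwind (C ∷ st) ++ arch t
  unwind-∷ []         = refl
  unwind-∷ st@(_ ∷ _) = sym (++-assoc (unwind st) (u ∷ word C) (arch t))
  lemma : ∀ (a b c e f g : List Step) → a ++ b ++ ((c ++ e) ++ f) ++ g ≡ ((a ++ b ++ c) ++ e ++ f) ++ g
  lemma a b c e f g = solve (++-monoid Step)

-- The hypothesis keeps away the junk clause of `push`, where a v has neither a nonempty τ nor a
-- block in progress to belong to.
render-v : ∀ T σ D st ps → (T ≡ [] → ps ≢ []) →
  render (D ∷ st , push T σ ps) ≡ render (T ∷ σ ∷ D ∷ st , ps) ∷ʳ v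
render-v []      σ D st []                       ps≢[] = ⊥-elim (ps≢[] refl refl)
render-v []      σ D st ps@(block σ′ σs t T ∷ ps′) _ = begin
  w ++ (((climb σ ++ K) ++ Z) ++ R) ++ replicate (suc n) v
    ≡⟨ cong (λ V → w ++ (((climb σ ++ K) ++ Z) ++ R) ++ V) (replicate-∷ʳ n v) ⟩
  w ++ (((climb σ ++ K) ++ Z) ++ R) ++ replicate n v ∷ʳ v
    ≡⟨ lemma w [ u ] (word σ) K Z R (replicate n v) [ v ] ⟩
  render ([] ∷ σ ∷ D ∷ st , ps) ∷ʳ v ∎
  where
  open ≡-Reasoning
  w = unwind (D ∷ st)
  K = climb σ′ ++ climbs σs
  Z = word T ++ arch t
  R = concatMap ascent ps′
  n = sum (map plunges ps)
  lemma : ∀ (w x s K Z R V y : List Step) →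
    w ++ ((((x ++ s ++ x) ++ K) ++ Z) ++ R) ++ (V ++ y) ≡
    (((w ++ x ++ s) ++ x) ++ ((K ++ Z) ++ R) ++ V) ++ y
  lemma w x s K Z R V y = solve (++-monoid Step)
render-v (t ∷ T) σ D st ps                         _ = begin
  w ++ (((climb σ ++ []) ++ Z) ++ R) ++ replicate (suc n) v
    ≡⟨ cong (λ V → w ++ (((climb σ ++ []) ++ Z) ++ R) ++ V) (replicate-∷ʳ n v) ⟩
  w ++ (((climb σ ++ []) ++ Z) ++ R) ++ replicate n v ∷ʳ v
    ≡⟨ lemma w [ u ] (word σ) Z R (replicate n v) [ v ] ⟩
  render ((t ∷ T) ∷ σ ∷ D ∷ st , ps) ∷ʳ v ∎
  where
  open ≡-Reasoning
  w = unwind (D ∷ st)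
  Z = word T ++ arch t
  R = concatMap ascent ps
  n = sum (map plunges ps)
  lemma : ∀ (w x s Z R V y : List Step) →
    w ++ ((((x ++ s ++ x) ++ []) ++ Z) ++ R) ++ (V ++ y) ≡
    (((w ++ x ++ s) ++ x ++ Z) ++ R ++ V) ++ y
  lemma w x s Z R V y = solve (++-monoid Step)

-- At height h the stack has h + 1 forests. After a d above the axis the top forest is nonempty and
-- can serve as the τ of a following v. The exception at height 0 admits the initial state, treated
-- as if it followed a d; no v can come next there.
data Reached : Step → ℕ → State → Set where
  after-u : ∀ {h C st} → length st ≡ h → Reached u h (C ∷ st , [])
  after-d : ∀ {h C st} → length st ≡ h → (C ≡ [] → h ≡ 0) → Reached d h (C ∷ st , [])
  after-v : ∀ {h p st ps} → length st ≡ suc h → Reached v h (st , p ∷ ps)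

-- The word `render s ++ S` does not change while the parse moves along the walk. At the end the
-- stack is a single forest, and that forest has this word.
word-onto      : ∀ {r h S} s → Reached r h s → Walk r h S d 0 → ∃ λ F → word F ≡ render s ++ S
word-onto-step : ∀ {r h S} s x → render (δ s x) ≡ render s ∷ʳ x →
  Reached r h (δ s x) → Walk r h S d 0 → ∃ λ F → word F ≡ render s ++ x ∷ S

word-onto-step {S = S} s x eq reached w with F , e ← word-onto (δ s x) reached w =
  F , trans e (trans (cong (_++ S) eq) (++-assoc (render s) [ x ] S))

word-onto (C ∷ [] , []) (after-d _ _) [] = C , sym (trans (++-identityʳ _) (++-identityʳ _))
word-onto s@(C ∷ st , []) (after-u eq) (up _ w) =
  word-onto-step s u (render-u C st) (after-u (cong suc eq)) w
word-onto s@(C ∷ st , []) (after-d eq _) (up _ w) =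
  word-onto-step s u (render-u C st) (after-u (cong suc eq)) w
word-onto _ (after-v _) (up r≢v w) = ⊥-elim (r≢v refl)
word-onto s@(B ∷ C ∷ st , []) (after-u eq) (down w) =
  word-onto-step s d (render-d B C st []) (after-d (ℕ.suc-injective eq) (λ ())) w
word-onto s@(B ∷ C ∷ st , []) (after-d eq _) (down w) =
  word-onto-step s d (render-d B C st []) (after-d (ℕ.suc-injective eq) (λ ())) w
word-onto s@(B ∷ C ∷ st , ps@(_ ∷ _)) (after-v eq) (down w) =
  word-onto-step s d (render-d B C st ps)
    (after-d (ℕ.suc-injective (ℕ.suc-injective eq)) (λ ())) w
word-onto _ (after-u _) (plunge r≢u _) = ⊥-elim (r≢u refl)
word-onto ([] ∷ st , []) (after-d _ c) (plunge _ _) with () ← c refl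
word-onto s@((t ∷ T) ∷ σ ∷ D ∷ st , []) (after-d eq _) (plunge _ w) =
  word-onto-step s v (render-v (t ∷ T) σ D st [] (λ ()))
    (after-v (ℕ.suc-injective eq)) w
word-onto s@([] ∷ σ ∷ D ∷ st , ps@(block _ _ _ _ ∷ _)) (after-v eq) (plunge _ w) =
  word-onto-step s v (render-v [] σ D st ps (λ _ ()))
    (after-v (ℕ.suc-injective (ℕ.suc-injective eq))) w
word-onto s@((t ∷ T) ∷ σ ∷ D ∷ st , ps@(_ ∷ _)) (after-v eq) (plunge _ w) =
  word-onto-step s v (render-v (t ∷ T) σ D st ps (λ _ ()))
    (after-v (ℕ.suc-injective (ℕ.suc-injective eq))) w

-- Returns, axis valleys and the recursion step

-- The walk is read one level higher, so it stays at height at least 1 and contains no return.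
returnIndexFrom-walk : ∀ {r h S s k} m X → Walk r h S s k →
  returnIndexFrom (+ suc h) (suc m) (S ++ X) ≡ length S + returnIndexFrom (+ suc k) (suc m) X
returnIndexFrom-walk m X []           = refl
returnIndexFrom-walk {h = h} m X (up _ w) rewrite ℕ.+-comm h 1 = cong suc (returnIndexFrom-walk m X w)
returnIndexFrom-walk m X (down w)     = cong suc (returnIndexFrom-walk m X w)
returnIndexFrom-walk m X (plunge _ w) = cong suc (returnIndexFrom-walk m X w)

returnIndexFrom-arch : ∀ t m X →
  returnIndexFrom 0ℤ (suc m) (arch t ++ X) ≡ length (arch t) + returnIndexFrom 0ℤ m X
returnIndexFrom-arch t m X = cong suc (begin
  returnIndexFrom 1ℤ (suc m) ((shaft t ++ [ d ]) ++ X)  ≡⟨ cong (returnIndexFrom 1ℤ (suc m)) (++-assoc (shaft t) [ d ] X) ⟩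
  returnIndexFrom 1ℤ (suc m) (shaft t ++ d ∷ X)         ≡⟨ returnIndexFrom-walk m (d ∷ X) (proj₂ (shaft-walk t)) ⟩
  length (shaft t) + (1 + returnIndexFrom 0ℤ m X)       ≡⟨ ℕ.+-assoc (length (shaft t)) 1 _ ⟨
  length (shaft t) + 1 + returnIndexFrom 0ℤ m X         ≡⟨ cong (_+ returnIndexFrom 0ℤ m X) (length-++ (shaft t)) ⟨
  length (shaft t ++ [ d ]) + returnIndexFrom 0ℤ m X    ∎)
  where open ≡-Reasoning

returnIndexFrom-word : ∀ F m X →
  returnIndexFrom 0ℤ (length F + m) (word F ++ X) ≡ length (word F) + returnIndexFrom 0ℤ m X
returnIndexFrom-word []      m X = refl
returnIndexFrom-word (t ∷ F) m X = begin
  returnIndexFrom 0ℤ (suc (length F + m)) ((word F ++ arch t) ++ X)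
    ≡⟨ cong₂ (returnIndexFrom 0ℤ) (sym (ℕ.+-suc (length F) m)) (++-assoc (word F) (arch t) X) ⟩
  returnIndexFrom 0ℤ (length F + suc m) (word F ++ arch t ++ X)
    ≡⟨ returnIndexFrom-word F (suc m) (arch t ++ X) ⟩
  length (word F) + returnIndexFrom 0ℤ (suc m) (arch t ++ X)
    ≡⟨ cong (λ i → length (word F) + i) (returnIndexFrom-arch t m X) ⟩
  length (word F) + (length (arch t) + returnIndexFrom 0ℤ m X)
    ≡⟨ ℕ.+-assoc (length (word F)) _ _ ⟨
  length (word F) + length (arch t) + returnIndexFrom 0ℤ m X
    ≡⟨ cong (_+ returnIndexFrom 0ℤ m X) (length-++ (word F)) ⟨
  length (word F ++ arch t) + returnIndexFrom 0ℤ m X ∎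
  where open ≡-Reasoning

-- The returns are the last steps of the arches. This turns the indices in the definition of ψ into
-- lengths of words of forests.
returnIndex-word : ∀ F X → returnIndex (+ length F) (word F ++ X) ≡ length (word F)
returnIndex-word F X = begin
  returnIndexFrom 0ℤ (length F) (word F ++ X)      ≡⟨ cong (λ m → returnIndexFrom 0ℤ m (word F ++ X)) (ℕ.+-identityʳ _) ⟨
  returnIndexFrom 0ℤ (length F + 0) (word F ++ X)  ≡⟨ returnIndexFrom-word F 0 X ⟩
  length (word F) + 0                              ≡⟨ ℕ.+-identityʳ _ ⟩
  length (word F)                                  ∎
  where open ≡-Reasoning

axisValleysFrom-walk : ∀ {r h S s k} X → Walk r h S s k →
  axisValleysFrom (+ suc h) (S ++ X) ≡ axisValleysFrom (+ suc k) X
axisValleysFrom-walk X []           = refl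
axisValleysFrom-walk {h = h} X (up _ w) rewrite ℕ.+-comm h 1 = axisValleysFrom-walk X w
axisValleysFrom-walk X (down w)     = axisValleysFrom-walk X w
axisValleysFrom-walk X (plunge _ w) = axisValleysFrom-walk X w

-- The inside of an arch has no valley on the axis. Whether its last d begins one depends on the
-- next step, so this d remains on the right.
axisValleysFrom-arch : ∀ t X →
  axisValleysFrom 0ℤ (arch t ++ X) ≡ axisValleysFrom 1ℤ (d ∷ X)
axisValleysFrom-arch t X = trans
  (cong (axisValleysFrom 1ℤ) (++-assoc (shaft t) [ d ] X))
  (axisValleysFrom-walk (d ∷ X) (proj₂ (shaft-walk t)))

axisValleysFrom-word : ∀ F X →
  axisValleysFrom 0ℤ (word F ++ u ∷ X) ≡ length F + axisValleysFrom 0ℤ (u ∷ X)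
axisValleysFrom-word []      X = refl
axisValleysFrom-word (t ∷ F) X = begin
  axisValleysFrom 0ℤ ((word F ++ arch t) ++ u ∷ X)  ≡⟨ cong (axisValleysFrom 0ℤ) (++-assoc (word F) (arch t) _) ⟩
  axisValleysFrom 0ℤ (word F ++ arch t ++ u ∷ X)    ≡⟨ axisValleysFrom-word F _ ⟩
  length F + axisValleysFrom 0ℤ (arch t ++ u ∷ X)   ≡⟨ cong (λ i → length F + i) (axisValleysFrom-arch t (u ∷ X)) ⟩
  length F + suc (axisValleysFrom 0ℤ (u ∷ X))       ≡⟨ ℕ.+-suc (length F) _ ⟩
  suc (length F + axisValleysFrom 0ℤ (u ∷ X))       ∎
  where open ≡-Reasoning

word-∷-≢[] : ∀ t F → word (t ∷ F) ≢ []
word-∷-≢[] t F eq with () ← ++-conicalʳ (word F) (arch t) eq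

vox-nonempty : ∀ {S} → S ≢ [] → vox S ≡ + axisValleysFrom 0ℤ S
vox-nonempty {[]}    S≢[] = ⊥-elim (S≢[] refl)
vox-nonempty {_ ∷ _} _    = refl

-- Every arch except the last, `arch t`, is followed by the u of another arch and so ends in an axis
-- valley.
vox-word : ∀ t F → vox (word (t ∷ F)) ≡ + length F
vox-word t F = trans (vox-nonempty (word-∷-≢[] t F)) (cong +_ (begin
  axisValleysFrom 0ℤ (word F ++ arch t)        ≡⟨ axisValleysFrom-word F _ ⟩
  length F + axisValleysFrom 0ℤ (arch t)       ≡⟨ cong (λ S → length F + axisValleysFrom 0ℤ S) (++-identityʳ (arch t)) ⟨
  length F + axisValleysFrom 0ℤ (arch t ++ []) ≡⟨ cong (λ i → length F + i) (axisValleysFrom-arch t []) ⟩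
  length F + 0                                 ≡⟨ ℕ.+-identityʳ _ ⟩
  length F                                     ∎))
  where open ≡-Reasoning

take-length-++ : ∀ {A : Set} (xs ys : List A) → take (length xs) (xs ++ ys) ≡ xs
take-length-++ []       ys = refl
take-length-++ (x ∷ xs) ys = cong (x ∷_) (take-length-++ xs ys)

drop-length-++ : ∀ {A : Set} (xs ys : List A) → drop (length xs) (xs ++ ys) ≡ ys
drop-length-++ []       ys = refl
drop-length-++ (x ∷ xs) ys = drop-length-++ xs ys

factor-++ : ∀ xs ys zs → factor (length xs) (length (xs ++ ys)) (xs ++ ys ++ zs) ≡ ys
factor-++ xs ys zs = begin
  drop (length xs) (take (length (xs ++ ys)) (xs ++ ys ++ zs))
    ≡⟨ cong (drop (length xs) ∘ take (length (xs ++ ys))) (++-assoc xs ys zs) ⟨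
  drop (length xs) (take (length (xs ++ ys)) ((xs ++ ys) ++ zs))
    ≡⟨ cong (drop (length xs)) (take-length-++ (xs ++ ys) zs) ⟩
  drop (length xs) (xs ++ ys)
    ≡⟨ drop-length-++ xs ys ⟩
  ys ∎
  where open ≡-Reasoning

-- This computes the index p of case (2), with `s` the step before the final run of v's.
dropWhile-v : ∀ S {s} n → s ≢ v →
  length (dropWhileᵇ isV (reverse (S ∷ʳ s ++ replicate n v))) ≡ length (S ∷ʳ s)
dropWhile-v S {s} zero s≢v = begin
  length (dropWhileᵇ isV (reverse (S ∷ʳ s ++ [])))
    ≡⟨ cong (length ∘ dropWhileᵇ isV ∘ reverse) (++-identityʳ (S ∷ʳ s)) ⟩
  length (dropWhileᵇ isV (reverse (S ∷ʳ s)))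
    ≡⟨ cong (length ∘ dropWhileᵇ isV) (reverse-++ S [ s ]) ⟩
  length (dropWhileᵇ isV (s ∷ reverse S))
    ≡⟨ cong length (kept s s≢v) ⟩
  length (s ∷ reverse S)
    ≡⟨ cong length (reverse-++ S [ s ]) ⟨
  length (reverse (S ∷ʳ s))
    ≡⟨ length-reverse (S ∷ʳ s) ⟩
  length (S ∷ʳ s) ∎
  where
  open ≡-Reasoning
  kept : ∀ s → s ≢ v → dropWhileᵇ isV (s ∷ reverse S) ≡ s ∷ reverse S
  kept u _   = refl
  kept d _   = refl
  kept v v≢v = ⊥-elim (v≢v refl)
dropWhile-v S {s} (suc n) s≢v = begin
  length (dropWhileᵇ isV (reverse (S ∷ʳ s ++ replicate (suc n) v)))
    ≡⟨ cong (λ V → length (dropWhileᵇ isV (reverse (S ∷ʳ s ++ V)))) (replicate-∷ʳ n v) ⟩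
  length (dropWhileᵇ isV (reverse (S ∷ʳ s ++ replicate n v ∷ʳ v)))
    ≡⟨ cong (length ∘ dropWhileᵇ isV ∘ reverse) (++-assoc (S ∷ʳ s) (replicate n v) [ v ]) ⟨
  length (dropWhileᵇ isV (reverse ((S ∷ʳ s ++ replicate n v) ∷ʳ v)))
    ≡⟨ cong (length ∘ dropWhileᵇ isV) (reverse-++ (S ∷ʳ s ++ replicate n v) [ v ]) ⟩
  length (dropWhileᵇ isV (reverse (S ∷ʳ s ++ replicate n v)))
    ≡⟨ dropWhile-v S n s≢v ⟩
  length (S ∷ʳ s) ∎
  where open ≡-Reasoning

walk-unsnoc : ∀ {r h S s k} → Walk r h S s k → ∃ λ S′ → r ∷ S ≡ S′ ∷ʳ s
walk-unsnoc []                                               = [] , refl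
walk-unsnoc {r} (up _ w)     with S , eq ← walk-unsnoc w = r ∷ S , cong (r ∷_) eq
walk-unsnoc {r} (down w)     with S , eq ← walk-unsnoc w = r ∷ S , cong (r ∷_) eq
walk-unsnoc {r} (plunge _ w) with S , eq ← walk-unsnoc w = r ∷ S , cong (r ∷_) eq

cancel-part : ∀ x y z → (y ℤ.+ (z ℤ.+ x)) ℤ.+ ℤ.- x ℤ.- y ≡ z
cancel-part = ℤ-Solver.solve-∀

-- There are h + 1 arches, and a is the number of those in `Bs`; return h + 1 - a therefore ends
-- `word As`, and the new u and d enclose `word Bs`.
extend-one : ∀ h Bs As → h ℤ.+ 1ℤ ≡ + length (Bs ++ As) →
  extend h (word (Bs ++ As)) ⟨ + length Bs ⨾1⟩ ≡ word (node Bs ∷ As)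
extend-one h Bs As eq = begin
  take p S ++ u ∷ drop p S ++ [ d ]
    ≡⟨ cong₂ (λ p S → take p S ++ u ∷ drop p S ++ [ d ]) p≡ (word-++ Bs As) ⟩
  take (length α) (α ++ β) ++ u ∷ drop (length α) (α ++ β) ++ [ d ]
    ≡⟨ cong₂ (λ α β → α ++ u ∷ β ++ [ d ]) (take-length-++ α β) (drop-length-++ α β) ⟩
  α ++ u ∷ β ++ [ d ]
    -- The shaft of a `node` ends with an empty run of v's.
    ≡⟨ cong (λ β → α ++ u ∷ β ++ [ d ]) (++-identityʳ β) ⟨
  word (node Bs ∷ As) ∎
  where
  open ≡-Reasoning
  S = word (Bs ++ As)
  α = word As
  β = word Bs
  p = returnIndex (h ℤ.+ 1ℤ ℤ.- + length Bs) S
  lemma : ∀ x y → (x ℤ.+ y) ℤ.- x ≡ y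
  lemma = ℤ-Solver.solve-∀
  index : h ℤ.+ 1ℤ ℤ.- + length Bs ≡ + length As
  index = begin
    h ℤ.+ 1ℤ ℤ.- + length Bs                      ≡⟨ cong (ℤ._- + length Bs) eq ⟩
    + length (Bs ++ As) ℤ.- + length Bs           ≡⟨ cong (λ n → + n ℤ.- + length Bs) (length-++ Bs) ⟩
    + length Bs ℤ.+ + length As ℤ.- + length Bs   ≡⟨ lemma (+ length Bs) (+ length As) ⟩
    + length As                                   ∎
  p≡ : p ≡ length α
  p≡ = trans (cong₂ returnIndex index (word-++ Bs As)) (returnIndex-word As β)

-- Case (2) of `extend` with the return indices and k abstracted; for their actual values the two
-- agree by computation.
assemble : (ℕ → ℕ) → ℕ → List Step → List Step
assemble j k S =
  take p S ++ concatMap (λ i → [ u ] ++ factor (j i) (j (suc i)) S ++ [ u ]) (upTo k)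
    ++ drop (j k) S ++ replicate k v ++ factor p (j 0) S
  where
  p = length (dropWhileᵇ isV (reverse (take (j 0 ∸ 1) S)))

++-regroup : ∀ (xs ys zs ws : List Step) → xs ++ (ys ++ zs) ++ ws ≡ (xs ++ ys) ++ zs ++ ws
++-regroup xs ys zs ws = solve (++-monoid Step)

-- In the induction the first σ moves into the prefix `P`, and the indices shift by one along with
-- it.
concat-factors : ∀ j P σs X →
  (∀ i → i ≤ length σs → j i ≡ length (P ++ concatMap word (take i σs))) →
  concat (applyUpTo (λ i → [ u ] ++ factor (j i) (j (suc i)) (P ++ concatMap word σs ++ X) ++ [ u ]) (length σs))
    ≡ climbs σs
concat-factors j P []       X j≡ = refl
concat-factors j P (σ ∷ σs) X j≡ = cong₂ (λ σ̂ K → (u ∷ σ̂ ++ [ u ]) ++ K) first rest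
  where
  open ≡-Reasoning
  S = P ++ (word σ ++ concatMap word σs) ++ X
  S≡ : S ≡ (P ++ word σ) ++ concatMap word σs ++ X
  S≡ = ++-regroup P (word σ) (concatMap word σs) X
  first : factor (j 0) (j 1) S ≡ word σ
  first = begin
    factor (j 0) (j 1) S
      ≡⟨ cong₂ (λ m n → factor m n S)
           (trans (j≡ 0 z≤n) (cong length (++-identityʳ P)))
           (trans (j≡ 1 (s≤s z≤n)) (cong (λ T → length (P ++ T)) (++-identityʳ (word σ)))) ⟩
    factor (length P) (length (P ++ word σ)) S
      ≡⟨ cong (factor (length P) (length (P ++ word σ))) (trans S≡ (++-assoc P (word σ) _)) ⟩
    factor (length P) (length (P ++ word σ)) (P ++ word σ ++ concatMap word σs ++ X)
      ≡⟨ factor-++ P (word σ) _ ⟩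
    word σ ∎
  rest : concat (applyUpTo (λ i → [ u ] ++ factor (j (suc i)) (j (suc (suc i))) S ++ [ u ]) (length σs)) ≡ climbs σs
  rest = trans
    (cong (λ S → concat (applyUpTo (λ i → [ u ] ++ factor (j (suc i)) (j (suc (suc i))) S ++ [ u ]) (length σs))) S≡)
    (concat-factors (j ∘ suc) (P ++ word σ) σs X
      (λ i i≤n → trans (j≡ (suc i) (s≤s i≤n)) (cong length (sym (++-assoc P (word σ) _)))))

-- The prefix `P` ends with the last d of the chosen arch, before which comes a run of exactly m
-- v's. So α is `A ∷ʳ s`, and β is this run followed by d.
assemble-factors : ∀ j A s m σs τ → s ≢ v →
  let P = (A ∷ʳ s ++ replicate m v) ∷ʳ d in
  (∀ i → i ≤ length σs → j i ≡ length (P ++ concatMap word (take i σs))) →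
  assemble j (length σs) (P ++ concatMap word σs ++ τ) ≡
    A ∷ʳ s ++ climbs σs ++ τ ++ replicate (length σs) v ++ replicate m v ++ [ d ]
assemble-factors j A s m σs τ s≢v j≡ =
  cong₂ _++_ α≡ (cong₂ _++_ σs≡ (cong₂ _++_ τ≡ (cong (replicate (length σs) v ++_) β≡)))
  where
  open ≡-Reasoning
  A′ = A ∷ʳ s
  V = replicate m v
  P = (A′ ++ V) ∷ʳ d
  X = concatMap word σs ++ τ
  S = P ++ X
  j₀≡ : j 0 ≡ length P
  j₀≡ = trans (j≡ 0 z≤n) (cong length (++-identityʳ P))
  p≡ : length (dropWhileᵇ isV (reverse (take (j 0 ∸ 1) S))) ≡ length A′
  p≡ = begin
    length (dropWhileᵇ isV (reverse (take (j 0 ∸ 1) S)))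
      ≡⟨ cong (λ n → length (dropWhileᵇ isV (reverse (take (n ∸ 1) S)))) j₀≡ ⟩
    length (dropWhileᵇ isV (reverse (take (length P ∸ 1) S)))
      -- Written as a successor, the length of `P` absorbs the `∸ 1`, which leaves out the final d.
      ≡⟨ cong (λ n → length (dropWhileᵇ isV (reverse (take (n ∸ 1) S))))
           (trans (length-++ (A′ ++ V)) (ℕ.+-comm _ 1)) ⟩
    length (dropWhileᵇ isV (reverse (take (length (A′ ++ V)) S)))
      ≡⟨ cong (λ S → length (dropWhileᵇ isV (reverse (take (length (A′ ++ V)) S)))) (++-assoc (A′ ++ V) [ d ] X) ⟩
    length (dropWhileᵇ isV (reverse (take (length (A′ ++ V)) ((A′ ++ V) ++ d ∷ X))))
      ≡⟨ cong (length ∘ dropWhileᵇ isV ∘ reverse) (take-length-++ (A′ ++ V) (d ∷ X)) ⟩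
    length (dropWhileᵇ isV (reverse (A′ ++ V)))
      ≡⟨ dropWhile-v A m s≢v ⟩
    length A′ ∎
  P≡ : P ≡ A′ ++ V ++ [ d ]
  P≡ = ++-assoc A′ V [ d ]
  S≡ : S ≡ A′ ++ (V ++ [ d ]) ++ X
  S≡ = trans (cong (_++ X) P≡) (++-assoc A′ (V ++ [ d ]) X)
  α≡ : take (length (dropWhileᵇ isV (reverse (take (j 0 ∸ 1) S)))) S ≡ A′
  α≡ = trans (cong₂ take p≡ S≡) (take-length-++ A′ _)
  β≡ : factor (length (dropWhileᵇ isV (reverse (take (j 0 ∸ 1) S)))) (j 0) S ≡ V ++ [ d ]
  β≡ = begin
    factor (length (dropWhileᵇ isV (reverse (take (j 0 ∸ 1) S)))) (j 0) S
      ≡⟨ cong₂ (λ p q → factor p q S) p≡ (trans j₀≡ (cong length P≡)) ⟩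
    factor (length A′) (length (A′ ++ V ++ [ d ])) S
      ≡⟨ cong (factor (length A′) (length (A′ ++ V ++ [ d ]))) S≡ ⟩
    factor (length A′) (length (A′ ++ V ++ [ d ])) (A′ ++ (V ++ [ d ]) ++ X)
      ≡⟨ factor-++ A′ (V ++ [ d ]) X ⟩
    V ++ [ d ] ∎
  τ≡ : drop (j (length σs)) S ≡ τ
  τ≡ = trans
    (cong₂ drop
      (trans (j≡ (length σs) ℕ.≤-refl)
             (cong (λ ρs → length (P ++ concatMap word ρs)) (take-all (length σs) σs ℕ.≤-refl)))
      (sym (++-assoc P (concatMap word σs) τ)))
    (drop-length-++ (P ++ concatMap word σs) τ)
  σs≡ : concatMap (λ i → [ u ] ++ factor (j i) (j (suc i)) S ++ [ u ]) (upTo (length σs)) ≡ climbs σs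
  σs≡ = trans (cong concat (map-upTo _ (length σs))) (concat-factors j P σs τ j≡)

negLength : List Tree → ℤ
negLength σ = ℤ.- + length σ

sumℤ-negLength : ∀ σs → sumℤ (map negLength σs) ≡ negLength (concat σs)
sumℤ-negLength []       = refl
sumℤ-negLength (σ ∷ σs) = begin
  negLength σ ℤ.+ sumℤ (map negLength σs)   ≡⟨ cong (λ x → negLength σ ℤ.+ x) (sumℤ-negLength σs) ⟩
  negLength σ ℤ.+ negLength (concat σs)     ≡⟨ ℤ.neg-distrib-+ (+ length σ) (+ length (concat σs)) ⟨
  ℤ.- + (length σ + length (concat σs))     ≡⟨ cong (λ n → ℤ.- + n) (length-++ σ) ⟨
  negLength (σ ++ concat σs)                ∎
  where open ≡-Reasoning

length-pile : ∀ G σs → length (pile G σs) ≡ length G + length (concat σs)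
length-pile G []       = sym (ℕ.+-identityʳ _)
length-pile G (σ ∷ σs) = begin
  length (pile (σ ++ G) σs)                         ≡⟨ length-pile (σ ++ G) σs ⟩
  length (σ ++ G) + length (concat σs)              ≡⟨ cong (_+ length (concat σs)) (length-++-comm σ G) ⟩
  length (G ++ σ) + length (concat σs)              ≡⟨ cong (_+ length (concat σs)) (length-++ G) ⟩
  length G + length σ + length (concat σs)          ≡⟨ ℕ.+-assoc (length G) _ _ ⟩
  length G + (length σ + length (concat σs))        ≡⟨ cong (λ n → length G + n) (length-++ σ) ⟨
  length G + length (σ ++ concat σs)                ∎
  where open ≡-Reasoning

-- Of the h + 1 arches, subtracting a removes those of τ, and adding b_{i+1}, ..., b_k removes those
-- of σ_{i+1}, ..., σ_k. What remains is the pile of `c ∷ As` and σ₁, ..., σᵢ, so j₀ ends the arch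
-- `c` and jᵢ ends σᵢ.
extend-parts : ∀ h c σ σs t T As →
  let G = t ∷ T ++ pile (c ∷ As) (σ ∷ σs) in
  h ℤ.+ 1ℤ ≡ + length G →
  extend h (word G) ⟨ + suc (length T) ⨾ negLength σ ∷ map negLength σs ⟩ ≡ word (grow c σ σs t T ∷ As)
extend-parts h c σ σs t T As eq = begin
  assemble j (suc (length (map negLength σs))) (word G)
    ≡⟨ cong (λ n → assemble j (suc n) (word G)) (length-map negLength σs) ⟩
  assemble j k (word G)
    ≡⟨ cong (assemble j k) (trans G≡ (cong (_++ concatMap word ρs ++ τ) P≡)) ⟩
  assemble j k (((A ∷ʳ top c ++ V) ∷ʳ d) ++ concatMap word ρs ++ τ)
    ≡⟨ assemble-factors j A (top c) (depth c) ρs τ (top≢v c)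
         (λ i _ → trans (j≡ i) (cong (λ P → length (P ++ concatMap word (take i ρs))) P≡)) ⟩
  A ∷ʳ top c ++ climbs ρs ++ τ ++ replicate k v ++ V ++ [ d ]
    ≡⟨ cong (_++ climbs ρs ++ τ ++ replicate k v ++ V ++ [ d ]) A≡ ⟨
  (word As ++ u ∷ core c) ++ climbs ρs ++ τ ++ replicate k v ++ V ++ [ d ]
    ≡⟨ lemma₂ (word As) [ u ] (core c) (climbs ρs) τ (replicate k v) V [ d ] ⟩
  word As ++ u ∷ ((core c ++ climbs ρs ++ τ) ++ replicate k v ++ V) ++ [ d ]
    ≡⟨ cong (λ W → word As ++ u ∷ ((core c ++ climbs ρs ++ τ) ++ W) ++ [ d ]) (replicate-+ k (depth c) v) ⟨
  word (grow c σ σs t T ∷ As) ∎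
  where
  open ≡-Reasoning
  ρs = σ ∷ σs
  k  = length ρs
  G  = t ∷ T ++ pile (c ∷ As) ρs
  τ  = word (t ∷ T)
  V  = replicate (depth c) v
  P  = word (c ∷ As)
  -- The starting height 0 is arbitrary: only the last step of `u ∷ core c` matters.
  A  = word As ++ proj₁ (walk-unsnoc (core-walk c {0}))
  j : ℕ → ℕ
  j i = returnIndex (h ℤ.+ 1ℤ ℤ.+ sumℤ (drop i (map negLength ρs)) ℤ.- + length (t ∷ T)) (word G)
  A≡ : word As ++ u ∷ core c ≡ A ∷ʳ top c
  A≡ = trans (cong (word As ++_) (proj₂ (walk-unsnoc (core-walk c {0})))) (sym (++-assoc (word As) _ _))
  P≡ : P ≡ (A ∷ʳ top c ++ V) ∷ʳ d
  P≡ = trans (lemma₁ (word As) [ u ] (core c) V [ d ]) (cong (λ A → (A ++ V) ∷ʳ d) A≡)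
    where
    lemma₁ : ∀ (a x b c y : List Step) → a ++ x ++ (b ++ c) ++ y ≡ ((a ++ x ++ b) ++ c) ++ y
    lemma₁ a x b c y = solve (++-monoid Step)
  lemma₂ : ∀ (a x b c e f g y : List Step) →
    (a ++ x ++ b) ++ c ++ e ++ f ++ g ++ y ≡ a ++ x ++ ((b ++ c ++ e) ++ f ++ g) ++ y
  lemma₂ a x b c e f g y = solve (++-monoid Step)
  G≡ : word G ≡ P ++ concatMap word ρs ++ τ
  G≡ = trans (word-++ (t ∷ T) (pile (c ∷ As) ρs))
    (trans (cong (_++ τ) (word-pile (c ∷ As) ρs)) (++-assoc P (concatMap word ρs) τ))
  index : ∀ i → h ℤ.+ 1ℤ ℤ.+ sumℤ (drop i (map negLength ρs)) ℤ.- + length (t ∷ T) ≡ + length (pile (c ∷ As) (take i ρs))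
  index i = begin
    h ℤ.+ 1ℤ ℤ.+ sumℤ (drop i (map negLength ρs)) ℤ.- + y
      ≡⟨ cong₂ (λ z w → z ℤ.+ w ℤ.- + y) eq
           (trans (cong sumℤ (drop-map i ρs)) (sumℤ-negLength (drop i ρs))) ⟩
    + length G ℤ.+ ℤ.- + x ℤ.- + y
      ≡⟨ cong (λ n → + n ℤ.+ ℤ.- + x ℤ.- + y) length-G ⟩
    (+ y ℤ.+ (+ z ℤ.+ + x)) ℤ.+ ℤ.- + x ℤ.- + y
      ≡⟨ cancel-part (+ x) (+ y) (+ z) ⟩
    + z ∎
    where
    x = length (concat (drop i ρs))
    y = length (t ∷ T)
    z = length (pile (c ∷ As) (take i ρs))
    length-G : length G ≡ y + (z + x)
    length-G = begin
      length G                                ≡⟨ length-++ (t ∷ T) ⟩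
      y + length (pile (c ∷ As) ρs)           ≡⟨ cong (λ ρs → y + length (pile (c ∷ As) ρs)) (take++drop≡id i ρs) ⟨
      y + length (pile (c ∷ As) (take i ρs ++ drop i ρs))
        ≡⟨ cong (λ G → y + length G) (foldl-++ (flip _++_) (c ∷ As) (take i ρs) (drop i ρs)) ⟩
      y + length (pile (pile (c ∷ As) (take i ρs)) (drop i ρs))
        ≡⟨ cong (λ n → y + n) (length-pile (pile (c ∷ As) (take i ρs)) (drop i ρs)) ⟩
      y + (z + x) ∎
  j≡ : ∀ i → j i ≡ length (P ++ concatMap word (take i ρs))
  j≡ i = begin
    j i
      ≡⟨ cong₂ returnIndex (index i) split ⟩
    returnIndex (+ length (pile (c ∷ As) (take i ρs)))
      (word (pile (c ∷ As) (take i ρs)) ++ concatMap word (drop i ρs) ++ τ)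
      ≡⟨ returnIndex-word (pile (c ∷ As) (take i ρs)) _ ⟩
    length (word (pile (c ∷ As) (take i ρs)))
      ≡⟨ cong length (word-pile (c ∷ As) (take i ρs)) ⟩
    length (P ++ concatMap word (take i ρs)) ∎
    where
    split : word G ≡ word (pile (c ∷ As) (take i ρs)) ++ concatMap word (drop i ρs) ++ τ
    split = begin
      word G
        ≡⟨ G≡ ⟩
      P ++ concatMap word ρs ++ τ
        ≡⟨ cong (λ ρs → P ++ concatMap word ρs ++ τ) (take++drop≡id i ρs) ⟨
      P ++ concatMap word (take i ρs ++ drop i ρs) ++ τ
        ≡⟨ cong (λ W → P ++ W ++ τ) (concatMap-++ word (take i ρs) (drop i ρs)) ⟩
      P ++ (concatMap word (take i ρs) ++ concatMap word (drop i ρs)) ++ τ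
        ≡⟨ ++-regroup P (concatMap word (take i ρs)) (concatMap word (drop i ρs)) τ ⟩
      (P ++ concatMap word (take i ρs)) ++ concatMap word (drop i ρs) ++ τ
        ≡⟨ cong (_++ concatMap word (drop i ρs) ++ τ) (word-pile (c ∷ As) (take i ρs)) ⟨
      word (pile (c ∷ As) (take i ρs)) ++ concatMap word (drop i ρs) ++ τ ∎

-- Labeled paths and forests

-- The graph of ψ, with forests in place of their words.
data Encodes : List Label → List Tree → Set where
  empty : Encodes [] [ node [] ]
  one   : ∀ {Q} Bs As → Encodes Q (Bs ++ As) → Encodes (Q ∷ʳ ⟨ + length Bs ⨾1⟩) (node Bs ∷ As)
  parts : ∀ {Q} c σ σs t T As → Encodes Q (t ∷ T ++ pile (c ∷ As) (σ ∷ σs)) →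
    Encodes (Q ∷ʳ ⟨ + suc (length T) ⨾ negLength σ ∷ map negLength σs ⟩) (grow c σ σs t T ∷ As)

encodes-≢[] : ∀ {Q} → ¬ Encodes Q []
encodes-≢[] ()

-- The first tree of the list determines the rule and its arguments, except that `node []` alone
-- also has the form of a conclusion of `one [] []`; its premise would encode the empty forest.
encodes-injective : ∀ {Q Q′ F} → Encodes Q F → Encodes Q′ F → Q ≡ Q′
encodes-injective empty           empty             = refl
encodes-injective empty           (one [] [] e)     = ⊥-elim (encodes-≢[] e)
encodes-injective (one [] [] e)   empty             = ⊥-elim (encodes-≢[] e)
encodes-injective (one Bs As e)   (one .Bs .As e′)  = cong (_∷ʳ _) (encodes-injective e e′)
encodes-injective (parts c σ σs t T As e) (parts .c .σ .σs .t .T .As e′) =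
  cong (_∷ʳ _) (encodes-injective e e′)

endpoint-∷ʳ : ∀ Q l → endpoint (map step (Q ∷ʳ l)) ≡ endpoint (map step Q) ⊕ step l
endpoint-∷ʳ Q l = trans (cong endpoint (map-++ step Q [ l ])) (foldl-∷ʳ _⊕_ origin (step l) (map step Q))

height-∷ʳ : ∀ Q l → height (Q ∷ʳ l) ≡ height Q ℤ.+ (proj₂ (step l) ℤ.- proj₁ (step l))
height-∷ʳ Q l = trans
  (cong (λ p → proj₂ p ℤ.- proj₁ p) (endpoint-∷ʳ Q l))
  (lemma (proj₁ (endpoint (map step Q))) (proj₂ (endpoint (map step Q))) (proj₁ (step l)) (proj₂ (step l)))
  where
  lemma : ∀ x y a b → (y ℤ.+ b) ℤ.- (x ℤ.+ a) ≡ (y ℤ.- x) ℤ.+ (b ℤ.- a)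
  lemma = ℤ-Solver.solve-∀

scanl-∷ʳ : ∀ {A B : Set} (f : A → B → A) e xs x →
  scanl f e (xs ∷ʳ x) ≡ scanl f e xs ∷ʳ foldl f e (xs ∷ʳ x)
scanl-∷ʳ f e []       x = refl
scanl-∷ʳ f e (y ∷ ys) x = cong (e ∷_) (scanl-∷ʳ f (f e y) ys x)

vertices-∷ʳ : ∀ Q l →
  vertices (map step (Q ∷ʳ l)) ≡ vertices (map step Q) ∷ʳ endpoint (map step (Q ∷ʳ l))
vertices-∷ʳ Q l = begin
  vertices (map step (Q ∷ʳ l))    ≡⟨ cong vertices (map-++ step Q [ l ]) ⟩
  vertices (map step Q ∷ʳ step l) ≡⟨ scanl-∷ʳ _⊕_ origin (map step Q) (step l) ⟩
  vertices (map step Q) ∷ʳ endpoint (map step Q ∷ʳ step l)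
    ≡⟨ cong (λ P → vertices (map step Q) ∷ʳ endpoint P) (map-++ step Q [ l ]) ⟨
  vertices (map step Q) ∷ʳ endpoint (map step (Q ∷ʳ l)) ∎
  where open ≡-Reasoning

labeledFPath-∷ʳ⁺ : ∀ {Q l} → LabeledFPath Q → F (step l) → ValidLabel l → 0ℤ ℤ.≤ height (Q ∷ʳ l) →
  LabeledFPath (Q ∷ʳ l)
labeledFPath-∷ʳ⁺ {Q} {l} ((steps , above) , valid) f vl h≥0 =
  ( subst (All F) (sym (map-++ step Q [ l ])) (++⁺ steps (f ∷ []))
  , subst (All _) (sym (vertices-∷ʳ Q l)) (++⁺ above (ℤ.0≤i-j⇒j≤i h≥0 ∷ [])) )
  , ++⁺ valid (vl ∷ [])

labeledFPath-∷ʳ⁻ : ∀ {Q l} → LabeledFPath (Q ∷ʳ l) →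
  LabeledFPath Q × F (step l) × ValidLabel l × 0ℤ ℤ.≤ height (Q ∷ʳ l)
labeledFPath-∷ʳ⁻ {Q} {l} ((steps , above) , valid) =
  ( (++⁻ˡ (map step Q) steps′ , ++⁻ˡ (vertices (map step Q)) above′) , ++⁻ˡ Q valid )
  , All.head (++⁻ʳ (map step Q) steps′)
  , All.head (++⁻ʳ Q valid)
  , ℤ.i≤j⇒0≤j-i (All.head (++⁻ʳ (vertices (map step Q)) above′))
  where
  steps′ = subst (All F) (map-++ step Q [ l ]) steps
  above′ = subst (All _) (vertices-∷ʳ Q l) above

-- In `one` the last a trees become a single tree; in `parts` the a trees of τ and all trees of the
-- σ's disappear into the tree grown from `c`. Either way the number of trees changes as the height
-- does.
encodes-height : ∀ {Q F} → Encodes Q F → height Q ℤ.+ 1ℤ ≡ + length F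
encodes-height empty = refl
encodes-height (one {Q} Bs As e) = begin
  height (Q ∷ʳ ⟨ + length Bs ⨾1⟩) ℤ.+ 1ℤ              ≡⟨ cong (ℤ._+ 1ℤ) (height-∷ʳ Q _) ⟩
  height Q ℤ.+ (1ℤ ℤ.- + length Bs) ℤ.+ 1ℤ            ≡⟨ lemma₁ (height Q) (+ length Bs) ⟩
  height Q ℤ.+ 1ℤ ℤ.- + length Bs ℤ.+ 1ℤ
    ≡⟨ cong (λ z → z ℤ.- + length Bs ℤ.+ 1ℤ) (trans (encodes-height e) (cong +_ (length-++ Bs))) ⟩
  (+ length Bs ℤ.+ + length As) ℤ.- + length Bs ℤ.+ 1ℤ ≡⟨ lemma₂ (+ length Bs) (+ length As) ⟩
  1ℤ ℤ.+ + length As                                 ∎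
  where
  open ≡-Reasoning
  lemma₁ : ∀ h x → h ℤ.+ (1ℤ ℤ.- x) ℤ.+ 1ℤ ≡ h ℤ.+ 1ℤ ℤ.- x ℤ.+ 1ℤ
  lemma₁ = ℤ-Solver.solve-∀
  lemma₂ : ∀ x y → (x ℤ.+ y) ℤ.- x ℤ.+ 1ℤ ≡ 1ℤ ℤ.+ y
  lemma₂ = ℤ-Solver.solve-∀
encodes-height (parts {Q} c σ σs t T As e) = begin
  height (Q ∷ʳ l) ℤ.+ 1ℤ
    ≡⟨ cong (ℤ._+ 1ℤ) (height-∷ʳ Q l) ⟩
  height Q ℤ.+ (sumℤ (map negLength ρs) ℤ.- a) ℤ.+ 1ℤ
    ≡⟨ lemma (height Q) (sumℤ (map negLength ρs)) a ⟩
  (height Q ℤ.+ 1ℤ) ℤ.+ sumℤ (map negLength ρs) ℤ.- a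
    ≡⟨ cong₂ (λ z w → z ℤ.+ w ℤ.- a)
         (trans (encodes-height e) (cong +_
           (trans (length-++ (t ∷ T)) (cong (λ n → suc (length T) + n) (length-pile (c ∷ As) ρs)))))
         (sumℤ-negLength ρs) ⟩
  (a ℤ.+ (+ suc (length As) ℤ.+ b)) ℤ.+ ℤ.- b ℤ.- a
    ≡⟨ cancel-part b a (+ suc (length As)) ⟩
  + suc (length As) ∎
  where
  open ≡-Reasoning
  ρs = σ ∷ σs
  a = + suc (length T)
  b = + length (concat ρs)
  l = ⟨ a ⨾ negLength σ ∷ map negLength σs ⟩
  lemma : ∀ h x y → h ℤ.+ (x ℤ.- y) ℤ.+ 1ℤ ≡ h ℤ.+ 1ℤ ℤ.+ x ℤ.- y
  lemma = ℤ-Solver.solve-∀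

encodes-height-∷ : ∀ {Q t F} → Encodes Q (t ∷ F) → height Q ≡ + length F
encodes-height-∷ {Q} {F = F} e = begin
  height Q                         ≡⟨ lemma (height Q) ⟨
  height Q ℤ.+ 1ℤ ℤ.- 1ℤ           ≡⟨ cong (ℤ._- 1ℤ) (encodes-height e) ⟩
  1ℤ ℤ.+ + length F ℤ.- 1ℤ         ≡⟨ lemma′ (+ length F) ⟩
  + length F                       ∎
  where
  open ≡-Reasoning
  lemma : ∀ h → h ℤ.+ 1ℤ ℤ.- 1ℤ ≡ h
  lemma = ℤ-Solver.solve-∀
  lemma′ : ∀ h → 1ℤ ℤ.+ h ℤ.- 1ℤ ≡ h
  lemma′ = ℤ-Solver.solve-∀

negLength≤0 : ∀ σ → negLength σ ℤ.≤ 0ℤ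
negLength≤0 σ = ℤ.neg-mono-≤ (ℤ.+≤+ (z≤n {length σ}))

allNegLength≤0 : ∀ σs → All (ℤ._≤ 0ℤ) (map negLength σs)
allNegLength≤0 σs = map⁺ (All.universal negLength≤0 σs)

sumℤ≤0 : ∀ {bs} → All (ℤ._≤ 0ℤ) bs → sumℤ bs ℤ.≤ 0ℤ
sumℤ≤0 []       = ℤ.≤-refl
sumℤ≤0 (p ∷ ps) = ℤ.+-mono-≤ p (sumℤ≤0 ps)

-- Not going below the diagonal means nonnegative height, which holds because every encoded forest
-- is nonempty.
encodes-labeledFPath : ∀ {Q F} → Encodes Q F → LabeledFPath Q
encodes-labeledFPath empty = ([] , ℤ.≤-refl ∷ []) , []
encodes-labeledFPath e@(one Bs As e′) =
  labeledFPath-∷ʳ⁺ (encodes-labeledFPath e′) (rise (ℤ.+≤+ z≤n)) one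
    (subst (0ℤ ℤ.≤_) (sym (encodes-height-∷ e)) (ℤ.+≤+ z≤n))
encodes-labeledFPath e@(parts c σ σs t T As e′) =
  labeledFPath-∷ʳ⁺ (encodes-labeledFPath e′) (fall (ℤ.+≤+ (s≤s z≤n)) (sumℤ≤0 all≤0)) (parts all≤0)
    (subst (0ℤ ℤ.≤_) (sym (encodes-height-∷ e)) (ℤ.+≤+ z≤n))
  where
  all≤0 = allNegLength≤0 (σ ∷ σs)

-- For variable `Q` and `l`, `reverseView (Q ∷ʳ l)` does not reduce. Independence of the view yields
-- the recursion equation `ψ-∷ʳ`.
ψ-view-irrelevant : ∀ {Q Q′} (r : Reverse Q) (r′ : Reverse Q′) → Q ≡ Q′ → ψ-view r ≡ ψ-view r′
ψ-view-irrelevant []             []               _  = refl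
ψ-view-irrelevant []             (Q′ ∶ r′ ∶ʳ l′)  eq with () ← ++-conicalʳ Q′ _ (sym eq)
ψ-view-irrelevant (Q ∶ r ∶ʳ l)  []               eq with () ← ++-conicalʳ Q _ eq
ψ-view-irrelevant (Q ∶ r ∶ʳ l)  (Q′ ∶ r′ ∶ʳ l′)  eq with refl , refl ← ∷ʳ-injective Q Q′ eq =
  cong (λ S → extend (height Q) S l) (ψ-view-irrelevant r r′ refl)

ψ-∷ʳ : ∀ Q l → ψ (Q ∷ʳ l) ≡ extend (height Q) (ψ Q) l
ψ-∷ʳ Q l = ψ-view-irrelevant (reverseView (Q ∷ʳ l)) (Q ∶ reverseView Q ∶ʳ l) refl

encodes-ψ : ∀ {Q F} → Encodes Q F → ψ Q ≡ word F
encodes-ψ empty = refl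
encodes-ψ (one {Q} Bs As e) = begin
  ψ (Q ∷ʳ l)                              ≡⟨ ψ-∷ʳ Q l ⟩
  extend (height Q) (ψ Q) l               ≡⟨ cong (λ S → extend (height Q) S l) (encodes-ψ e) ⟩
  extend (height Q) (word (Bs ++ As)) l   ≡⟨ extend-one (height Q) Bs As (encodes-height e) ⟩
  word (node Bs ∷ As)                     ∎
  where
  open ≡-Reasoning
  l = ⟨ + length Bs ⨾1⟩
encodes-ψ (parts {Q} c σ σs t T As e) = begin
  ψ (Q ∷ʳ l)                              ≡⟨ ψ-∷ʳ Q l ⟩
  extend (height Q) (ψ Q) l               ≡⟨ cong (λ S → extend (height Q) S l) (encodes-ψ e) ⟩
  extend (height Q) (word (t ∷ T ++ pile (c ∷ As) (σ ∷ σs))) l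
    ≡⟨ extend-parts (height Q) c σ σs t T As (encodes-height e) ⟩
  word (grow c σ σs t T ∷ As)             ∎
  where
  open ≡-Reasoning
  l = ⟨ + suc (length T) ⨾ negLength σ ∷ map negLength σs ⟩

-- Widths and semilengths

width-replicate-v : ∀ n → width (replicate n v) ≡ 0
width-replicate-v zero    = refl
width-replicate-v (suc n) = width-replicate-v n

width-arch : ∀ t → width (arch t) ≡ 2 + width (core t)
width-arch t = cong suc (begin
  width (shaft t ++ [ d ])                               ≡⟨ width-++ (shaft t) [ d ] ⟩
  width (shaft t) + 1                                    ≡⟨ ℕ.+-comm (width (shaft t)) 1 ⟩
  suc (width (core t ++ replicate (depth t) v))          ≡⟨ cong suc (width-++ (core t) _) ⟩
  suc (width (core t) + width (replicate (depth t) v))   ≡⟨ cong (λ n → suc (width (core t) + n)) (width-replicate-v (depth t)) ⟩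
  suc (width (core t) + 0)                               ≡⟨ cong suc (ℕ.+-identityʳ _) ⟩
  suc (width (core t))                                   ∎)
  where open ≡-Reasoning

width-climbs : ∀ σs → width (climbs σs) ≡ 2 * length σs + width (concatMap word σs)
width-climbs []       = refl
width-climbs (σ ∷ σs) = begin
  suc (width ((word σ ++ [ u ]) ++ climbs σs))
    ≡⟨ cong suc (trans (width-++ (word σ ++ [ u ]) (climbs σs)) (cong₂ _+_ (width-++ (word σ) [ u ]) (width-climbs σs))) ⟩
  suc (width (word σ) + 1 + (2 * length σs + width (concatMap word σs)))
    ≡⟨ lemma (width (word σ)) (length σs) (width (concatMap word σs)) ⟩
  2 * suc (length σs) + (width (word σ) + width (concatMap word σs))
    ≡⟨ cong (λ n → 2 * suc (length σs) + n) (width-++ (word σ) (concatMap word σs)) ⟨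
  2 * suc (length σs) + width (word σ ++ concatMap word σs) ∎
  where
  open ≡-Reasoning
  lemma : ∀ x n y → suc (x + 1 + (2 * n + y)) ≡ 2 * suc n + (x + y)
  lemma = ℕ-Solver.solve-∀

width-node : ∀ Bs As → width (word (node Bs ∷ As)) ≡ 2 + width (word (Bs ++ As))
width-node Bs As = begin
  width (word As ++ arch (node Bs))          ≡⟨ width-++ (word As) _ ⟩
  width (word As) + width (arch (node Bs))   ≡⟨ cong (λ n → width (word As) + n) (width-arch (node Bs)) ⟩
  width (word As) + (2 + width (word Bs))    ≡⟨ lemma (width (word As)) (width (word Bs)) ⟩
  2 + (width (word As) + width (word Bs))    ≡⟨ cong (suc ∘ suc) (width-++ (word As) (word Bs)) ⟨
  2 + width (word As ++ word Bs)             ≡⟨ cong (λ S → 2 + width S) (word-++ Bs As) ⟨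
  2 + width (word (Bs ++ As))                ∎
  where
  open ≡-Reasoning
  lemma : ∀ x y → x + (2 + y) ≡ 2 + (x + y)
  lemma = ℕ-Solver.solve-∀

width-grow : ∀ c σ σs t T As → width (word (grow c σ σs t T ∷ As)) ≡
  2 * suc (length σs) + width (word (t ∷ T ++ pile (c ∷ As) (σ ∷ σs)))
width-grow c σ σs t T As = begin
  width (word As ++ arch (grow c σ σs t T))
    ≡⟨ width-++ (word As) _ ⟩
  a + width (arch (grow c σ σs t T))
    ≡⟨ cong (λ n → a + n) (width-arch (grow c σ σs t T)) ⟩
  a + (2 + width (core c ++ climbs ρs ++ word (t ∷ T)))
    ≡⟨ cong (λ n → a + (2 + n)) (trans (width-++ (core c) _)
         (cong (λ n → x + n) (trans (width-++ (climbs ρs) _) (cong (_+ τ) (width-climbs ρs))))) ⟩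
  a + (2 + (x + (2 * k + w + τ)))
    ≡⟨ lemma a x k w τ ⟩
  2 * k + ((a + (2 + x) + w) + τ)
    ≡⟨ cong (λ n → 2 * k + (n + τ)) piled ⟨
  2 * k + (width (word (pile (c ∷ As) ρs)) + τ)
    ≡⟨ cong (λ n → 2 * k + n) (width-++ (word (pile (c ∷ As) ρs)) _) ⟨
  2 * k + width (word (pile (c ∷ As) ρs) ++ word (t ∷ T))
    ≡⟨ cong (λ S → 2 * k + width S) (word-++ (t ∷ T) (pile (c ∷ As) ρs)) ⟨
  2 * k + width (word (t ∷ T ++ pile (c ∷ As) ρs)) ∎
  where
  open ≡-Reasoning
  ρs = σ ∷ σs
  a = width (word As)
  x = width (core c)
  k = suc (length σs)
  w = width (concatMap word ρs)
  τ = width (word (t ∷ T))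
  lemma : ∀ a x k w τ → a + (2 + (x + (2 * k + w + τ))) ≡ 2 * k + ((a + (2 + x) + w) + τ)
  lemma = ℕ-Solver.solve-∀
  piled : width (word (pile (c ∷ As) ρs)) ≡ a + (2 + x) + w
  piled = begin
    width (word (pile (c ∷ As) ρs))                ≡⟨ cong width (word-pile (c ∷ As) ρs) ⟩
    width (word (c ∷ As) ++ concatMap word ρs)     ≡⟨ width-++ (word (c ∷ As)) _ ⟩
    width (word (c ∷ As)) + w                      ≡⟨ cong (_+ w) (width-++ (word As) (arch c)) ⟩
    a + width (arch c) + w                         ≡⟨ cong (λ n → a + n + w) (width-arch c) ⟩
    a + (2 + x) + w                                ∎

semilength-∷ʳ : ∀ Q l → semilength (Q ∷ʳ l) ≡ semilength Q + labelSemilength l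
semilength-∷ʳ Q l = begin
  sum (map labelSemilength (Q ∷ʳ l))                      ≡⟨ cong sum (map-++ labelSemilength Q [ l ]) ⟩
  sum (map labelSemilength Q ∷ʳ labelSemilength l)        ≡⟨ sum-++ (map labelSemilength Q) _ ⟩
  semilength Q + (labelSemilength l + 0)                  ≡⟨ cong (λ n → semilength Q + n) (ℕ.+-identityʳ _) ⟩
  semilength Q + labelSemilength l                        ∎
  where open ≡-Reasoning

encodes-width : ∀ {Q F} → Encodes Q F → width (word F) ≡ 2 * suc (semilength Q)
encodes-width empty = refl
encodes-width (one {Q} Bs As e) = begin
  width (word (node Bs ∷ As))       ≡⟨ width-node Bs As ⟩
  2 + width (word (Bs ++ As))       ≡⟨ cong (λ n → 2 + n) (encodes-width e) ⟩
  2 + 2 * suc (semilength Q)        ≡⟨ lemma (semilength Q) ⟩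
  2 * suc (semilength Q + 1)        ≡⟨ cong (λ n → 2 * suc n) (semilength-∷ʳ Q _) ⟨
  2 * suc (semilength (Q ∷ʳ _))     ∎
  where
  open ≡-Reasoning
  lemma : ∀ n → 2 + 2 * suc n ≡ 2 * suc (n + 1)
  lemma = ℕ-Solver.solve-∀
encodes-width (parts {Q} c σ σs t T As e) = begin
  width (word (grow c σ σs t T ∷ As))
    ≡⟨ width-grow c σ σs t T As ⟩
  2 * suc (length σs) + width (word (t ∷ T ++ pile (c ∷ As) (σ ∷ σs)))
    ≡⟨ cong (λ n → 2 * suc (length σs) + n) (encodes-width e) ⟩
  2 * suc (length σs) + 2 * suc (semilength Q)
    ≡⟨ lemma (length σs) (semilength Q) ⟩
  2 * suc (semilength Q + suc (length σs))
    ≡⟨ cong (λ n → 2 * suc (semilength Q + suc n)) (length-map negLength σs) ⟨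
  2 * suc (semilength Q + suc (length (map negLength σs)))
    ≡⟨ cong (λ n → 2 * suc n) (semilength-∷ʳ Q _) ⟨
  2 * suc (semilength (Q ∷ʳ _)) ∎
  where
  open ≡-Reasoning
  lemma : ∀ k n → 2 * suc k + 2 * suc n ≡ 2 * suc (n + suc k)
  lemma = ℕ-Solver.solve-∀

-- The preceding forest is not a subterm of `F`, so the recursion is on a bound for the width, which
-- `width-node` and `width-grow` show to decrease. The forest with the single tree `node []` is the
-- base case.
encode : ∀ n F → F ≢ [] → width (word F) ≤ n → ∃ λ Q → Encodes Q F
encode n       []                    F≢[] _ = ⊥-elim (F≢[] refl)
encode n       (node [] ∷ [])        _    _ = [] , empty
encode n       (node Bs@(_ ∷ _) ∷ As) _ le with n | subst (_≤ n) (width-node Bs As) le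
... | suc m | s≤s le′ with Q , e ← encode m (Bs ++ As) (λ ()) (ℕ.≤-trans (ℕ.n≤1+n _) le′) = _ , one Bs As e
encode n       (node [] ∷ As@(_ ∷ _)) _ le with n | subst (_≤ n) (width-node [] As) le
... | suc m | s≤s le′ with Q , e ← encode m As (λ ()) (ℕ.≤-trans (ℕ.n≤1+n _) le′) = _ , one [] As e
encode n       (grow c σ σs t T ∷ As) _ le with n | subst (_≤ n) (width-grow c σ σs t T As) le
... | suc m | s≤s le′ with Q , e ← encode m (t ∷ T ++ pile (c ∷ As) (σ ∷ σs)) (λ ()) (ℕ.≤-trans (ℕ.m≤n+m _ _) le′) =
  _ , parts c σ σs t T As e

-- From labeled paths to forests

split : ∀ {A : Set} n (xs : List A) → n ≤ length xs → ∃₂ λ ys zs → xs ≡ ys ++ zs × length ys ≡ n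
split n xs n≤ = take n xs , drop n xs , sym (take++drop≡id n xs)
  , trans (length-take n xs) (ℕ.m≤n⇒m⊓n≡m n≤)

negLengths : ∀ {bs} → All (ℤ._≤ 0ℤ) bs → ∃ λ ms → bs ≡ map (λ m → ℤ.- + m) ms
negLengths [] = [] , refl
negLengths {+ 0 ∷ _}      (_ ∷ ps) with ms , refl ← negLengths ps = 0 ∷ ms , refl
negLengths { -[1+ n ] ∷ _} (_ ∷ ps) with ms , refl ← negLengths ps = suc n ∷ ms , refl
negLengths {+ suc _ ∷ _}  (ℤ.+≤+ () ∷ _)

sumℤ-neg : ∀ ms → sumℤ (map (λ m → ℤ.- + m) ms) ≡ ℤ.- + sum ms
sumℤ-neg []       = refl
sumℤ-neg (m ∷ ms) = trans (cong (λ z → ℤ.- + m ℤ.+ z) (sumℤ-neg ms)) (sym (ℤ.neg-distrib-+ (+ m) (+ sum ms)))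

-- The later forests of a pile come first in its list. They are split off by the recursive call, and
-- the forest of size m is then cut from the front of the remainder.
unpile : ∀ ms G → sum ms ≤ length G →
  ∃₂ λ R σs → G ≡ pile R σs × map length σs ≡ ms × length G ≡ length R + sum ms
unpile []       G _ = G , [] , refl , refl , sym (ℕ.+-identityʳ _)
unpile (m ∷ ms) G le with unpile ms G (ℕ.≤-trans (ℕ.m≤n+m (sum ms) m) le)
... | R , σs , refl , refl , eq
  with split m R (ℕ.+-cancelʳ-≤ (sum (map length σs)) m (length R) (subst (m + sum (map length σs) ≤_) eq le))
... | σ , R′ , refl , refl = R′ , σ ∷ σs , refl , refl , trans eq
  (trans (cong (_+ s) (trans (length-++ σ) (ℕ.+-comm (length σ) (length R′)))) (ℕ.+-assoc (length R′) (length σ) s))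
  where
  s = sum (map length σs)

-- Here x is the change of height in the last step. In case (1) x is 1 - a, so a trees are
-- available; in case (2) x is b - a, so there is one tree beyond the a - b trees of τ and the σ's,
-- and it serves as `c`.
encodes-fits : ∀ {Q G} → Encodes Q G → ∀ x m → 0ℤ ℤ.≤ height Q ℤ.+ x → 1ℤ ℤ.- x ≡ + m → m ≤ length G
encodes-fits {Q} {G} e x m h+x≥0 1-x≡m = ℤ.drop‿+≤+ (ℤ.0≤i-j⇒j≤i {+ length G} {+ m} (subst (0ℤ ℤ.≤_) (begin
  height Q ℤ.+ x                       ≡⟨ lemma (height Q) x ⟩
  height Q ℤ.+ 1ℤ ℤ.- (1ℤ ℤ.- x)       ≡⟨ cong₂ ℤ._-_ (encodes-height e) 1-x≡m ⟩
  + length G ℤ.- + m                   ∎) h+x≥0))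
  where
  open ≡-Reasoning
  lemma : ∀ h x → h ℤ.+ x ≡ h ℤ.+ 1ℤ ℤ.- (1ℤ ℤ.- x)
  lemma = ℤ-Solver.solve-∀

F-nonneg : ∀ {p} → F p → 0ℤ ℤ.≤ proj₁ p
F-nonneg (rise 0≤a)   = 0≤a
F-nonneg (fall 1≤a _) = ℤ.≤-trans (ℤ.+≤+ z≤n) 1≤a

F-pos : ∀ {p} → F p → proj₂ p ℤ.≤ 0ℤ → 1ℤ ℤ.≤ proj₁ p
F-pos (rise _)     (ℤ.+≤+ ())
F-pos (fall 1≤a _) _ = 1≤a

1-[1-x]≡x : ∀ x → 1ℤ ℤ.- (1ℤ ℤ.- x) ≡ x
1-[1-x]≡x = ℤ-Solver.solve-∀

-- Nonnegative height guarantees enough trees, so `G` can be cut into pieces of the sizes that the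
-- label prescribes.
encodes-∷ʳ : ∀ {Q G l} → Encodes Q G → F (step l) → ValidLabel l → 0ℤ ℤ.≤ height (Q ∷ʳ l) →
  ∃ λ F → Encodes (Q ∷ʳ l) F
encodes-∷ʳ {Q} {G} {⟨ a ⨾1⟩} e f one h≥0
  with ℤ.+≤+ {n = n} _ ← F-nonneg f
  with Bs , As , refl , refl ← split n G
    (encodes-fits e _ n (subst (0ℤ ℤ.≤_) (height-∷ʳ Q _) h≥0) (1-[1-x]≡x (+ n)))
  = _ , one Bs As e
encodes-∷ʳ {Q} {G} {⟨ a ⨾ b ∷ bs ⟩} e f (parts bs≤0) h≥0
  with m ∷ ms , refl ← negLengths bs≤0
  with ℤ.+≤+ {n = suc n} _ ← F-pos f (sumℤ≤0 bs≤0)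
  = build
  where
  s = sum (m ∷ ms)
  lemma : ∀ a s → 1ℤ ℤ.- (ℤ.- s ℤ.- a) ≡ a ℤ.+ (1ℤ ℤ.+ s)
  lemma = ℤ-Solver.solve-∀
  fits : suc n + suc s ≤ length G
  fits = encodes-fits e _ (suc n + suc s) (subst (0ℤ ℤ.≤_) (height-∷ʳ Q _) h≥0)
    (trans (cong (λ z → 1ℤ ℤ.- (z ℤ.- + suc n)) (sumℤ-neg (m ∷ ms))) (lemma (+ suc n) (+ s)))
  build : ∃ λ F → Encodes (Q ∷ʳ ⟨ + suc n ⨾ ℤ.- + m ∷ map (λ m → ℤ.- + m) ms ⟩) F
  build with split (suc n) G (ℕ.m+n≤o⇒m≤o _ fits)
  ... | t ∷ T , G′ , refl , refl
    with suc-s≤ ← ℕ.+-cancelˡ-≤ (suc n) (suc s) (length G′) (subst (suc n + suc s ≤_) (length-++ (t ∷ T)) fits)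
    with unpile (m ∷ ms) G′ (ℕ.≤-trans (ℕ.n≤1+n s) suc-s≤)
  -- The bound `suc s` on the length of `G′` leaves at least one tree after the σ's are removed.
  ... | [] , σ ∷ σs , refl , refl , eq = ⊥-elim (ℕ.<-irrefl refl (subst (suc s ≤_) eq suc-s≤))
  ... | c ∷ As , σ ∷ σs , refl , refl , eq = _ ,
    subst (λ bs → Encodes (Q ∷ʳ ⟨ + suc n ⨾ negLength σ ∷ bs ⟩) (grow c σ σs t T ∷ As))
      (map-∘ σs) (parts c σ σs t T As e)

forest : ∀ {Q} → Reverse Q → LabeledFPath Q → ∃ λ F → Encodes Q F
forest []               _    = _ , empty
forest (Q ∶ r ∶ʳ l) path
  with path′ , f , valid , h≥0 ← labeledFPath-∷ʳ⁻ {Q} {l} path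
  = encodes-∷ʳ (proj₂ (forest r path′)) f valid h≥0

-- The bijection

ψ-UVD : ∀ n Q → LF n Q → UVD (suc n) (ψ Q)
ψ-UVD n Q (path , refl) with forest (reverseView Q) path
... | []    , e = ⊥-elim (encodes-≢[] e)
... | t ∷ F , e = subst (UVD (suc n)) (sym (encodes-ψ e))
  (walk⇒UVD (encodes-width e) (word-∷-≢[] t F) (word-walk (t ∷ F) (λ ())))

ψ-injective : ∀ {Q Q′} → LabeledFPath Q → LabeledFPath Q′ → ψ Q ≡ ψ Q′ → Q ≡ Q′
ψ-injective {Q} {Q′} path path′ eq
  with F , e ← forest (reverseView Q) path
  with F′ , e′ ← forest (reverseView Q′) path′
  with refl ← word-injective {F} {F′} (trans (sym (encodes-ψ e)) (trans eq (encodes-ψ e′)))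
  = encodes-injective e e′

ψ-onto : ∀ {n S} → UVD n S → ∃ λ Q → LabeledFPath Q × ψ Q ≡ S
ψ-onto {S = []} S∈UVD with () ← UVD.ends-in-d S∈UVD
ψ-onto {S = S@(_ ∷ _)} S∈UVD
  -- The initial state has one empty forest at height 0 and renders as the empty word.
  with word-onto ([ [] ] , []) (after-d refl (λ _ → refl)) (UVD⇒walk S∈UVD)
... | []    , ()
... | t ∷ F , eq with Q , e ← encode _ (t ∷ F) (λ ()) ℕ.≤-refl
  = Q , encodes-labeledFPath e , trans (encodes-ψ e) eq

height≡vox : ∀ {Q} → LabeledFPath Q → height Q ≡ vox (ψ Q)
height≡vox {Q} path with forest (reverseView Q) path
... | []    , e = ⊥-elim (encodes-≢[] e)
... | t ∷ F , e = trans (encodes-height-∷ e) (sym (trans (cong vox (encodes-ψ e)) (vox-word t F)))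

theorem3p2 : (Σ[ ψ-maps ∈ (∀ n (Q : List Label) → LF n Q → UVD (suc n) (ψ Q)) ]
    Bijective {A = ∃ (⋃ ℕ LF)} {B = ∃ (⋃ ℕ (λ n → UVD (suc n)))}
    (_≡_ on proj₁) (_≡_ on proj₁)
    (λ (Q , n , Q∈LFₙ) → ψ Q , n , ψ-maps n Q Q∈LFₙ))
    × (∀ (Q : List Label) → LabeledFPath Q → height Q ≡ vox (ψ Q))
theorem3p2 =
  ( ψ-UVD
  , (λ { {_ , _ , path , _} {_ , _ , path′ , _} → ψ-injective path path′ })
  , λ { (_ , _ , S∈UVD) → let Q , path , eq = ψ-onto S∈UVD in
        -- Elements are compared by their first components only, so the preimage may carry its own
        -- semilength as index.
        (Q , semilength Q , path , refl) , λ { refl → eq } } )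
  , λ _ → height≡vox
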